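{- Let $d,D\in\mathbb{Z}_{>0}$ with $D$ squarefree. If $(d,D)\neq(1,1)$, then $$\mathcal{GP}_{(1,1,1,d)}(\mathbb{Q}(\sqrt{ -D}))=\mathcal{GP}_{(1,1,1,d)}(\mathbb{Q})=\begin{cases}\{(\pm 3,3,\pm 3)\} & \text{if } d=1,\\ \{(\pm 1,1,\pm 1)\} & \text{if } d=3,\\ \emptyset & \text{if } d\neq 1,3,\end{cases}$$ and $\mathcal{GP}_{(1,1,1,1)}(\mathbb{Q}(i))=\{(\pm 3,3,\pm 3),(\pm i,-1,\mp i)\}$.
   Context: For a number field $K$ with ring of integers $\mathcal{O}_K$ and $a,b,c,d\in\mathcal{O}_K$, $\mathcal{GP}_{(a,b,c,d)}(K)$ denotes the set of non-trivial triples $(x,y,z)\in\mathcal{O}_K^3$ in geometric progression satisfying $ax^2+by^2+cz^2=dxyz$. Here $(x,y,z)$ is in geometric progression over $\mathcal{O}_K$ if there exist $\alpha,\beta\in\mathcal{O}_K$ with $x=\alpha$, $y=\alpha\beta$, $z=\alpha\beta^2$; it is non-trivial if $\alpha\neq 0$ (i.e. $(x,y,z)\neq(0,0,0)$). Signs are correlated: $(\pm r,s,\pm t)$ stands for the two triples $(r,s,t)$ and $(-r,s,-t)$, and $(\pm i,-1,\mp i)$ stands for the two triples $(i,-1,-i)$ and $(-i,-1,i)$. -}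

module Defs where

open import Algebra.Apartness.Bundles using (HeytingCommutativeRing; HeytingField)
open import Algebra.Bundles using (CommutativeRing)
import Algebra.Definitions
open import Algebra.Morphism.Structures using (module RingMorphisms)
import Algebra.Properties.Group as GroupProperties
import Algebra.Properties.Monoid.Sum as MonoidSum
import Algebra.Structures
import Relation.Binary.Reasoning.Setoid as ≈-Reasoning
open import Data.Fin.Base using (Fin; zero; suc)
open import Data.Integer.Base as ℤ using (ℤ; +_; -[1+_]; +0; +[1+_])
open import Data.List.Base using (List; []; _∷_; _++_)
open import Data.Nat.Base as ℕ using (ℕ; zero; suc; NonZero)
open import Data.Nat.Divisibility using (_∣_)
open import Data.Product.Base using (Σ-syntax; ∃-syntax; _×_; _,_; proj₁)
open import Data.Rational.Base as ℚ using (ℚ; 0ℚ; 1ℚ; _/_)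
import Data.Rational.Properties as ℚ
open import Data.Rational.Solver using (module +-*-Solver)
open import Data.Sum.Base using (_⊎_; inj₁; inj₂)
open import Function.Base using (_∘_; id)
open import Level using (Level; _⊔_; 0ℓ) renaming (suc to lsuc)
open import Relation.Binary.Definitions using (DecidableEquality; tri<; tri≈; tri>)
import Relation.Binary.Properties.DecSetoid as DecSetoidProperties
open import Relation.Binary.PropositionalEquality
  using (_≡_; _≢_; refl; sym; trans; cong; cong₂; isEquivalence)
import Relation.Binary.PropositionalEquality.Properties as ≡
open import Relation.Nullary using (¬_; yes; no; contradiction)
open import Relation.Unary using (Pred)

ℤ⇒ℚ : ℤ → ℚ
ℤ⇒ℚ z = z / 1

ℤ⇒ℚ-neg : ∀ z → ℤ⇒ℚ (ℤ.- z) ≡ ℚ.- ℤ⇒ℚ z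
ℤ⇒ℚ-neg +0       = refl
ℤ⇒ℚ-neg +[1+ n ] = refl
ℤ⇒ℚ-neg -[1+ n ] = sym (GroupProperties.⁻¹-involutive ℚ.+-0-group (ℤ⇒ℚ +[1+ n ]))

Squarefree : ℕ → Set
Squarefree n = ∀ m → m ℕ.* m ∣ n → m ≡ 1

record NumberField (k ℓ₁ ℓ₂ : Level) : Set (lsuc (k ⊔ ℓ₁ ⊔ ℓ₂)) where
  field
    heytingField : HeytingField k ℓ₁ ℓ₂

  open HeytingField heytingField public using (heytingCommutativeRing)
  open CommutativeRing (HeytingCommutativeRing.commutativeRing heytingCommutativeRing) public

  open MonoidSum +-monoid using (sum)

  field
    fromℚ      : ℚ → Carrier
    fromℚ-homo : RingMorphisms.IsRingHomomorphism ℚ.+-*-rawRing rawRing fromℚ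

    -- Finiteness over ℚ: the generators span, but need not be independent.
    rank       : ℕ
    generators : Fin rank → Carrier
    spanning   : ∀ x → Σ[ q ∈ (Fin rank → ℚ) ] x ≈ sum {rank} (λ j → fromℚ (q j) * generators j)

  fromℤ : ℤ → Carrier
  fromℤ z = fromℚ (ℤ⇒ℚ z)

  -- The list c₀ ∷ … ∷ cₙ₋₁ ∷ [] encodes the monic polynomial
  -- Xⁿ + cₙ₋₁ Xⁿ⁻¹ + … + c₀, evaluated here by Horner's rule.
  evalMonic : List ℤ → Carrier → Carrier
  evalMonic []       x = 1#
  evalMonic (c ∷ cs) x = fromℤ c + x * evalMonic cs x

  Integral : Pred Carrier ℓ₁
  Integral x = ∃[ cs ] evalMonic cs x ≈ 0#

  𝓞 : Set (k ⊔ ℓ₁)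
  𝓞 = Σ[ x ∈ Carrier ] Integral x

  fromℤ-integral : ∀ z → Integral (fromℤ z)
  fromℤ-integral z = (ℤ.- z ∷ []) , (begin
    fromℤ (ℤ.- z) + fromℤ z * 1#          ≈⟨ +-congˡ (*-identityʳ _) ⟩
    fromℤ (ℤ.- z) + fromℤ z               ≈⟨ F.+-homo _ _ ⟨
    fromℚ (ℤ⇒ℚ (ℤ.- z) ℚ.+ ℤ⇒ℚ z)         ≈⟨ F.⟦⟧-cong (cong (ℚ._+ ℤ⇒ℚ z) (ℤ⇒ℚ-neg z)) ⟩
    fromℚ (ℚ.- ℤ⇒ℚ z ℚ.+ ℤ⇒ℚ z)           ≈⟨ F.⟦⟧-cong (ℚ.+-inverseˡ (ℤ⇒ℚ z)) ⟩
    fromℚ 0ℚ                              ≈⟨ F.0#-homo ⟩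
    0#                                    ∎)
    where
    module F = RingMorphisms.IsRingHomomorphism fromℚ-homo
    open ≈-Reasoning setoid

  ℤ⇒𝓞 : ℤ → 𝓞
  ℤ⇒𝓞 z = fromℤ z , fromℤ-integral z

  Triple : Set k
  Triple = Carrier × Carrier × Carrier

  GeometricProgression : 𝓞 → 𝓞 → Pred Triple ℓ₁
  GeometricProgression (α , _) (β , _) (x , y , z) =
    x ≈ α × y ≈ α * β × z ≈ α * (β * β)

  GP : (a b c d : 𝓞) → Pred Triple (k ⊔ ℓ₁)
  GP (a , _) (b , _) (c , _) (d , _) t@(x , y , z) =
      (Integral x × Integral y × Integral z)
    × (∃[ α ] ∃[ β ] GeometricProgression α β t × ¬ (proj₁ α ≈ 0#))
    × a * (x * x) + b * (y * y) + c * (z * z) ≈ d * (x * y * z)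

  -- The signs are correlated: two triples, not four.
  [±_,_,±_] : Carrier → Carrier → Carrier → List Triple
  [± x , y ,± z ] = (x , y , z) ∷ (- x , y , - z) ∷ []

ℚ-numberField : NumberField 0ℓ 0ℓ 0ℓ
ℚ-numberField = record
  { heytingField = ℚ.heytingField
  ; fromℚ        = id
  ; fromℚ-homo   = record
    { isSemiringHomomorphism = record
      { isNearSemiringHomomorphism = record
        { +-isMonoidHomomorphism = record
          { isMagmaHomomorphism = record
            { isRelHomomorphism = record { cong = id }
            ; homo = λ _ _ → refl
            }
          ; ε-homo = refl
          }
        ; *-homo = λ _ _ → refl
        }
      ; 1#-homo = refl
      }
    ; -‿homo = λ _ → refl
    }
  ; rank       = 1
  ; generators = λ _ → 1ℚ
  ; spanning   = λ x → (λ _ → x) ,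
      sym (trans (ℚ.+-identityʳ (x ℚ.* 1ℚ)) (ℚ.*-identityʳ x))
  }

-- ⟨ a , b ⟩ is a + b√-D.
record Quadratic (D : ℕ) : Set where
  constructor ⟨_,_⟩
  field
    ratPart √Part : ℚ

positive-square : ∀ p → p ≢ 0ℚ → ℚ.Positive (p ℚ.* p)
positive-square p p≢0 with ℚ.<-cmp p 0ℚ
... | tri< p<0 _ _ = ℚ.neg*neg⇒pos p {{ℚ.negative p<0}} p {{ℚ.negative p<0}}
... | tri≈ _ p≡0 _ = contradiction p≡0 p≢0
... | tri> _ _ p>0 = ℚ.pos*pos⇒pos p {{ℚ.positive p>0}} p {{ℚ.positive p>0}}

nonNegative-square : ∀ p → ℚ.NonNegative (p ℚ.* p)
nonNegative-square p with p ℚ.≟ 0ℚ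
... | yes refl = _
... | no  p≢0  = ℚ.pos⇒nonNeg (p ℚ.* p) {{positive-square p p≢0}}

module QuadraticField (D : ℕ) .{{_ : NonZero D}} where

  K : Set
  K = Quadratic D

  δ : ℚ
  δ = ℤ⇒ℚ (+ D)

  infixl 6 _⊕_
  infixl 7 _⊗_

  _⊕_ _⊗_ : K → K → K
  ⟨ a , b ⟩ ⊕ ⟨ a′ , b′ ⟩ = ⟨ a ℚ.+ a′ , b ℚ.+ b′ ⟩
  ⟨ a , b ⟩ ⊗ ⟨ a′ , b′ ⟩ =
    ⟨ a ℚ.* a′ ℚ.- δ ℚ.* (b ℚ.* b′) , a ℚ.* b′ ℚ.+ b ℚ.* a′ ⟩

  ⊖_ : K → K
  ⊖ ⟨ a , b ⟩ = ⟨ ℚ.- a , ℚ.- b ⟩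

  ι : ℚ → K
  ι q = ⟨ q , 0ℚ ⟩

  𝟘 𝟙 √-D : K
  𝟘   = ι 0ℚ
  𝟙   = ι 1ℚ
  √-D = ⟨ 0ℚ , 1ℚ ⟩

  ⊗-comm : ∀ x y → x ⊗ y ≡ y ⊗ x
  ⊗-comm ⟨ a , b ⟩ ⟨ c , d ⟩ = cong₂ ⟨_,_⟩
    (solve 5 (λ a b c d e → a :* c :- e :* (b :* d) := c :* a :- e :* (d :* b)) refl a b c d δ)
    (solve 4 (λ a b c d → a :* d :+ b :* c := c :* b :+ d :* a) refl a b c d)
    where open +-*-Solver

  ⊗-assoc : ∀ x y z → (x ⊗ y) ⊗ z ≡ x ⊗ (y ⊗ z)
  ⊗-assoc ⟨ a , b ⟩ ⟨ c , d ⟩ ⟨ e , f ⟩ = cong₂ ⟨_,_⟩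
    (solve 7 (λ a b c d e f D →
      (a :* c :- D :* (b :* d)) :* e :- D :* ((a :* d :+ b :* c) :* f) :=
      a :* (c :* e :- D :* (d :* f)) :- D :* (b :* (c :* f :+ d :* e))) refl a b c d e f δ)
    (solve 7 (λ a b c d e f D →
      (a :* c :- D :* (b :* d)) :* f :+ (a :* d :+ b :* c) :* e :=
      a :* (c :* f :+ d :* e) :+ b :* (c :* e :- D :* (d :* f))) refl a b c d e f δ)
    where open +-*-Solver

  ⊗-identityˡ : ∀ x → 𝟙 ⊗ x ≡ x
  ⊗-identityˡ ⟨ a , b ⟩ = cong₂ ⟨_,_⟩
    (solve 3 (λ a b D → con 1ℚ :* a :- D :* (con 0ℚ :* b) := a) refl a b δ)
    (solve 2 (λ a b → con 1ℚ :* b :+ con 0ℚ :* a := b) refl a b)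
    where open +-*-Solver

  ⊗-identityʳ : ∀ x → x ⊗ 𝟙 ≡ x
  ⊗-identityʳ x = trans (⊗-comm x 𝟙) (⊗-identityˡ x)

  ⊗-distribˡ-⊕ : ∀ x y z → x ⊗ (y ⊕ z) ≡ x ⊗ y ⊕ x ⊗ z
  ⊗-distribˡ-⊕ ⟨ a , b ⟩ ⟨ c , d ⟩ ⟨ e , f ⟩ = cong₂ ⟨_,_⟩
    (solve 7 (λ a b c d e f D →
      a :* (c :+ e) :- D :* (b :* (d :+ f)) :=
      (a :* c :- D :* (b :* d)) :+ (a :* e :- D :* (b :* f))) refl a b c d e f δ)
    (solve 6 (λ a b c d e f →
      a :* (d :+ f) :+ b :* (c :+ e) :=
      (a :* d :+ b :* c) :+ (a :* f :+ b :* e)) refl a b c d e f)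
    where open +-*-Solver

  ⊗-distribʳ-⊕ : ∀ x y z → (y ⊕ z) ⊗ x ≡ y ⊗ x ⊕ z ⊗ x
  ⊗-distribʳ-⊕ x y z = trans (⊗-comm (y ⊕ z) x)
    (trans (⊗-distribˡ-⊕ x y z) (cong₂ _⊕_ (⊗-comm x y) (⊗-comm x z)))

  isCommutativeRing : Algebra.Structures.IsCommutativeRing (_≡_ {A = K}) _⊕_ _⊗_ ⊖_ 𝟘 𝟙
  isCommutativeRing = record
    { isRing = record
      { +-isAbelianGroup = record
        { isGroup = record
          { isMonoid = record
            { isSemigroup = record
              { isMagma = record { isEquivalence = isEquivalence ; ∙-cong = cong₂ _⊕_ }
              ; assoc   = λ { ⟨ a , b ⟩ ⟨ c , d ⟩ ⟨ e , f ⟩ →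
                              cong₂ ⟨_,_⟩ (ℚ.+-assoc a c e) (ℚ.+-assoc b d f) }
              }
            ; identity = (λ { ⟨ a , b ⟩ → cong₂ ⟨_,_⟩ (ℚ.+-identityˡ a) (ℚ.+-identityˡ b) })
                       , (λ { ⟨ a , b ⟩ → cong₂ ⟨_,_⟩ (ℚ.+-identityʳ a) (ℚ.+-identityʳ b) })
            }
          ; inverse = (λ { ⟨ a , b ⟩ → cong₂ ⟨_,_⟩ (ℚ.+-inverseˡ a) (ℚ.+-inverseˡ b) })
                    , (λ { ⟨ a , b ⟩ → cong₂ ⟨_,_⟩ (ℚ.+-inverseʳ a) (ℚ.+-inverseʳ b) })
          ; ⁻¹-cong = cong ⊖_
          }
        ; comm = λ { ⟨ a , b ⟩ ⟨ c , d ⟩ → cong₂ ⟨_,_⟩ (ℚ.+-comm a c) (ℚ.+-comm b d) }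
        }
      ; *-cong     = cong₂ _⊗_
      ; *-assoc    = ⊗-assoc
      ; *-identity = ⊗-identityˡ , ⊗-identityʳ
      ; distrib    = ⊗-distribˡ-⊕ , ⊗-distribʳ-⊕
      }
    ; *-comm = ⊗-comm
    }

  commutativeRing : CommutativeRing 0ℓ 0ℓ
  commutativeRing = record { isCommutativeRing = isCommutativeRing }

  open CommutativeRing commutativeRing using (+-group; zeroˡ; rawRing; +-monoid)

  _≟_ : DecidableEquality K
  ⟨ a , b ⟩ ≟ ⟨ c , d ⟩ with a ℚ.≟ c | b ℚ.≟ d
  ... | yes a≡c | yes b≡d = yes (cong₂ ⟨_,_⟩ a≡c b≡d)
  ... | no  a≢c | _       = no (a≢c ∘ cong Quadratic.ratPart)
  ... | yes _   | no b≢d  = no (b≢d ∘ cong Quadratic.√Part)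

  norm : K → ℚ
  norm ⟨ a , b ⟩ = a ℚ.* a ℚ.+ δ ℚ.* (b ℚ.* b)

  positive-δ : ℚ.Positive δ
  positive-δ = ℚ.normalize-pos D 1

  norm-nonZero : ∀ x → x ≢ 𝟘 → ℚ.NonZero (norm x)
  norm-nonZero ⟨ a , b ⟩ x≢𝟘 with a ℚ.≟ 0ℚ | b ℚ.≟ 0ℚ
  ... | yes refl | yes refl = contradiction refl x≢𝟘
  ... | no a≢0   | _        = ℚ.pos⇒nonZero (norm ⟨ a , b ⟩)
    {{ℚ.pos+nonNeg⇒pos (a ℚ.* a) {{positive-square a a≢0}} (δ ℚ.* (b ℚ.* b))
      {{ℚ.nonNeg*nonNeg⇒nonNeg δ {{ℚ.pos⇒nonNeg δ {{positive-δ}}}}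
        (b ℚ.* b) {{nonNegative-square b}}}}}}
  ... | yes _    | no b≢0   = ℚ.pos⇒nonZero (norm ⟨ a , b ⟩)
    {{ℚ.nonNeg+pos⇒pos (a ℚ.* a) {{nonNegative-square a}} (δ ℚ.* (b ℚ.* b))
      {{ℚ.pos*pos⇒pos δ {{positive-δ}} (b ℚ.* b) {{positive-square b b≢0}}}}}}

  inverse : ∀ x → x ≢ 𝟘 → ∃[ y ] x ⊗ y ≡ 𝟙
  inverse x@(⟨ a , b ⟩) x≢𝟘 = ⟨ a ℚ.* n , ℚ.- (b ℚ.* n) ⟩ , cong₂ ⟨_,_⟩
    (trans
      (solve 4 (λ a b n D → a :* (a :* n) :- D :* (b :* (:- (b :* n))) :=
        (a :* a :+ D :* (b :* b)) :* n) refl a b n δ)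
      (ℚ.*-inverseʳ (norm x)))
    (solve 3 (λ a b n → a :* (:- (b :* n)) :+ b :* (a :* n) := con 0ℚ) refl a b n)
    where
    open +-*-Solver
    instance
      _ : ℚ.NonZero (norm x)
      _ = norm-nonZero x x≢𝟘
    n = ℚ.1/ norm x

  open GroupProperties +-group using (x∙y⁻¹≈ε⇒x≈y; x≈y⇒x∙y⁻¹≈ε)
  open DecSetoidProperties (≡.decSetoid _≟_) using (≉-isApartnessRelation; ≉-tight)
  open Algebra.Definitions (_≡_ {A = K}) using (Invertible)

  ≢⇒invertible : ∀ {x y} → x ≢ y → Invertible 𝟙 _⊗_ (x ⊕ ⊖ y)
  ≢⇒invertible {x} {y} x≢y =
    let z , eq = inverse (x ⊕ ⊖ y) (x≢y ∘ x∙y⁻¹≈ε⇒x≈y x y)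
    in z , trans (⊗-comm z _) eq , eq

  invertible⇒≢ : ∀ {x y} → Invertible 𝟙 _⊗_ (x ⊕ ⊖ y) → x ≢ y
  invertible⇒≢ (z , _ , eq) x≡y = ℚ.1≢0 (cong Quadratic.ratPart
    (trans (sym eq) (trans (cong (_⊗ z) (x≈y⇒x∙y⁻¹≈ε x≡y)) (zeroˡ z))))

  heytingField : HeytingField 0ℓ 0ℓ 0ℓ
  heytingField = record
    { _#_            = _≢_
    ; isHeytingField = record
      { isHeytingCommutativeRing = record
        { isCommutativeRing   = isCommutativeRing
        ; isApartnessRelation = ≉-isApartnessRelation
        ; #⇒invertible        = ≢⇒invertible
        ; invertible⇒#        = invertible⇒≢
        }
      ; tight = ≉-tight
      }
    }

  ι-homo : RingMorphisms.IsRingHomomorphism ℚ.+-*-rawRing rawRing ι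
  ι-homo = record
    { isSemiringHomomorphism = record
      { isNearSemiringHomomorphism = record
        { +-isMonoidHomomorphism = record
          { isMagmaHomomorphism = record
            { isRelHomomorphism = record { cong = cong ι }
            ; homo = λ _ _ → refl
            }
          ; ε-homo = refl
          }
        ; *-homo = λ p q → cong₂ ⟨_,_⟩
            (solve 3 (λ p q D → p :* q := p :* q :- D :* con 0ℚ) refl p q δ)
            (solve 2 (λ p q → con 0ℚ := p :* con 0ℚ :+ con 0ℚ :* q) refl p q)
        }
      ; 1#-homo = refl
      }
    ; -‿homo = λ _ → refl
    }
    where open +-*-Solver

  basis : Fin 2 → K
  basis zero       = 𝟙
  basis (suc zero) = √-D

  coordinates : K → Fin 2 → ℚ
  coordinates ⟨ a , b ⟩ zero       = a
  coordinates ⟨ a , b ⟩ (suc zero) = b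

  basis-spanning : ∀ x → x ≡ MonoidSum.sum +-monoid (λ j → ι (coordinates x j) ⊗ basis j)
  basis-spanning ⟨ a , b ⟩ = cong₂ ⟨_,_⟩
    (solve 3 (λ a b D → a := (a :* con 1ℚ :- D :* con 0ℚ)
      :+ ((b :* con 0ℚ :- D :* (con 0ℚ :* con 1ℚ)) :+ con 0ℚ)) refl a b δ)
    (solve 2 (λ a b → b := (a :* con 0ℚ :+ con 0ℚ :* con 1ℚ)
      :+ ((b :* con 1ℚ :+ con 0ℚ :* con 0ℚ) :+ con 0ℚ)) refl a b)
    where open +-*-Solver

  numberField : NumberField 0ℓ 0ℓ 0ℓ
  numberField = record
    { heytingField = heytingField
    ; fromℚ        = ι
    ; fromℚ-homo   = ι-homo
    ; rank         = 2
    ; generators   = basis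
    ; spanning     = λ x → coordinates x , basis-spanning x
    }

ℚ[√-_] : (D : ℕ) .{{_ : NonZero D}} → NumberField 0ℓ 0ℓ 0ℓ
ℚ[√- D ] = QuadraticField.numberField D

𝓖𝓟₁₁₁ : (K : NumberField 0ℓ 0ℓ 0ℓ) → ℕ → Pred (NumberField.Triple K) 0ℓ
𝓖𝓟₁₁₁ K d = GP (ℤ⇒𝓞 (+ 1)) (ℤ⇒𝓞 (+ 1)) (ℤ⇒𝓞 (+ 1)) (ℤ⇒𝓞 (+ d))
  where open NumberField K

Image : (K : NumberField 0ℓ 0ℓ 0ℓ) → Pred (ℚ × ℚ × ℚ) 0ℓ → Pred (NumberField.Triple K) 0ℓ
Image K P (x , y , z) = ∃[ p ] ∃[ q ] ∃[ r ]
  P (p , q , r) × x ≈ fromℚ p × y ≈ fromℚ q × z ≈ fromℚ r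
  where open NumberField K

rationalSolutions : ℕ → List (ℚ × ℚ × ℚ)
rationalSolutions 1 = [± fromℤ (+ 3) , fromℤ (+ 3) ,± fromℤ (+ 3) ]
  where open NumberField ℚ-numberField
rationalSolutions 3 = [± fromℤ (+ 1) , fromℤ (+ 1) ,± fromℤ (+ 1) ]
  where open NumberField ℚ-numberField
rationalSolutions _ = []

gaussianSolutions : List (NumberField.Triple ℚ[√- 1 ])
gaussianSolutions = [± fromℤ (+ 3) , fromℤ (+ 3) ,± fromℤ (+ 3) ]
                 ++ [± i , - 1# ,± (- i) ]
  where
  open NumberField ℚ[√- 1 ]
  i = QuadraticField.√-D 1

{-# OPTIONS --safe #-}
module Submission where

-- For a solution (α, αβ, αβ²), dividing the equation by α² leaves
--
--   1 + β² + β⁴ = dαβ³,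
--
-- so β(dαβ² - β - β³) = 1 and β is a unit (reduce-equation, ratio-inverse).
-- In an imaginary quadratic field norms are nonnegative, so a unit has norm 1
-- (unit⇒norm≡1) and β⁻¹ is the conjugate of β.  Dividing the equation above by
-- β² then gives, with T = β + β⁻¹ the trace of β,
--
--   d·αβ = T² - 1   (middle-term),
--
-- so the middle term αβ of the progression is a rational integer Y, and the
-- progression is (Yβ⁻¹, Y, Yβ).  As β has norm 1, T² ≤ 4 (trace-bound), and
-- three cases remain (classify-trace).
--
--  * T = ±2: β = ±1 and dY = 3, which gives the rational solutions.
--  * T = ±1: Y = 0, so α = 0, which is excluded.
--  * T = 0: dY = -1, so d = 1 and Y = -1, while β = b√-D with Db² = 1.  Then
--    Db is an integer of square D, so D = 1 if D is squarefree, and β = ±i.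
--
-- The case of ℚ follows by embedding a rational solution in ℚ(√-D).
--
-- The argument needs that norms and traces of algebraic integers are rational
-- integers, and that sums and products of algebraic integers still have this
-- property.  Both come from complete integral closure.  Call x almost integral
-- if some positive integer m makes m·xᵏ lie in ℤ[√-D] for all k.  Algebraic
-- integers are almost integral (integral⇒almostIntegral), almost integral
-- elements form a ring stable under conjugation, and an almost integral
-- rational is an integer (rational-almostIntegral), since otherwise arbitrarily
-- large powers of its denominator would divide m.

open import Defs
open import Algebra.Apartness.Bundles using (HeytingCommutativeRing)
open import Algebra.Bundles using (CommutativeRing)
open import Algebra.Morphism.Structures using (module RingMorphisms)
import Algebra.Properties.CommutativeSemigroup as CommutativeSemigroupProperties
import Algebra.Properties.CommutativeSemiring.Exp as Exp
import Algebra.Properties.Group as GroupProperties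
import Algebra.Properties.Ring as RingProperties
import Algebra.Solver.Ring
open import Algebra.Solver.Ring.AlmostCommutativeRing
  using (_-Raw-AlmostCommutative⟶_; fromCommutativeRing)
open import Data.Integer.Base as ℤ using (ℤ; +_; -[1+_])
import Data.Integer.Properties as ℤ
open import Data.List.Base using (List; []; _∷_; length)
open import Data.List.Membership.Propositional using (_∈_)
open import Data.List.Relation.Unary.Any using (here; there)
import Data.Maybe.Base as Maybe
open import Data.Nat.Base as ℕ using (ℕ; zero; suc; NonZero; _≤_; _<_; z≤n; s≤s)
open import Data.Nat.Coprimality as Coprimality using (Coprime; coprime-divisor)
open import Data.Nat.Divisibility using (_∣_; divides; 1∣_; ∣⇒≤; *-monoʳ-∣)
import Data.Nat.Properties as ℕ
open import Data.Product.Base using (∃-syntax; _×_; _,_; proj₁; proj₂)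
open import Data.Rational.Base as ℚ using (ℚ; 0ℚ; 1ℚ; ½; ↥_; ↧_; ↧ₙ_; mkℚ)
import Data.Rational.Properties as ℚ
open import Data.Rational.Solver using (module +-*-Solver)
open import Data.Rational.Unnormalised.Base as ℚᵘ using (mkℚᵘ; *≡*; *≤*)
import Data.Rational.Unnormalised.Properties as ℚᵘ
open import Data.Sum.Base using (_⊎_; inj₁; inj₂)
open import Level using (0ℓ)
open import Relation.Binary.Consequences using (dec⇒weaklyDec)
open import Relation.Binary.PropositionalEquality
  using (_≡_; _≢_; refl; sym; trans; cong; cong₂; subst; subst₂; module ≡-Reasoning)
import Relation.Binary.Reasoning.Setoid as ≈-Reasoning
open import Relation.Nullary using (¬_; contradiction; yes; no)
open import Relation.Unary using (_≐_)

-- Integers among the rationals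

private
  toℚᵘ-ℤ⇒ℚ : ∀ z → ℚ.toℚᵘ (ℤ⇒ℚ z) ℚᵘ.≃ mkℚᵘ z 0
  toℚᵘ-ℤ⇒ℚ z = ℚ.toℚᵘ-fromℚᵘ (mkℚᵘ z 0)

ℤ⇒ℚ-+ : ∀ a b → ℤ⇒ℚ (a ℤ.+ b) ≡ ℤ⇒ℚ a ℚ.+ ℤ⇒ℚ b
ℤ⇒ℚ-+ a b = ℚ.toℚᵘ-injective (begin
  ℚ.toℚᵘ (ℤ⇒ℚ (a ℤ.+ b))                     ≈⟨ toℚᵘ-ℤ⇒ℚ (a ℤ.+ b) ⟩
  mkℚᵘ (a ℤ.+ b) 0                           ≡⟨ cong₂ (λ u v → mkℚᵘ (u ℤ.+ v) 0) (ℤ.*-identityʳ a) (ℤ.*-identityʳ b) ⟨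
  mkℚᵘ a 0 ℚᵘ.+ mkℚᵘ b 0                     ≈⟨ ℚᵘ.+-cong (toℚᵘ-ℤ⇒ℚ a) (toℚᵘ-ℤ⇒ℚ b) ⟨
  ℚ.toℚᵘ (ℤ⇒ℚ a) ℚᵘ.+ ℚ.toℚᵘ (ℤ⇒ℚ b)         ≈⟨ ℚ.toℚᵘ-homo-+ (ℤ⇒ℚ a) (ℤ⇒ℚ b) ⟨
  ℚ.toℚᵘ (ℤ⇒ℚ a ℚ.+ ℤ⇒ℚ b)                   ∎)
  where open ℚᵘ.≃-Reasoning

ℤ⇒ℚ-* : ∀ a b → ℤ⇒ℚ (a ℤ.* b) ≡ ℤ⇒ℚ a ℚ.* ℤ⇒ℚ b
ℤ⇒ℚ-* a b = ℚ.toℚᵘ-injective (begin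
  ℚ.toℚᵘ (ℤ⇒ℚ (a ℤ.* b))                     ≈⟨ toℚᵘ-ℤ⇒ℚ (a ℤ.* b) ⟩
  mkℚᵘ a 0 ℚᵘ.* mkℚᵘ b 0                     ≈⟨ ℚᵘ.*-cong (toℚᵘ-ℤ⇒ℚ a) (toℚᵘ-ℤ⇒ℚ b) ⟨
  ℚ.toℚᵘ (ℤ⇒ℚ a) ℚᵘ.* ℚ.toℚᵘ (ℤ⇒ℚ b)         ≈⟨ ℚ.toℚᵘ-homo-* (ℤ⇒ℚ a) (ℤ⇒ℚ b) ⟨
  ℚ.toℚᵘ (ℤ⇒ℚ a ℚ.* ℤ⇒ℚ b)                   ∎)
  where open ℚᵘ.≃-Reasoning

ℤ⇒ℚ-injective : ∀ {a b} → ℤ⇒ℚ a ≡ ℤ⇒ℚ b → a ≡ b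
ℤ⇒ℚ-injective {a} {b} eq with ℚ.fromℚᵘ-injective {mkℚᵘ a 0} {mkℚᵘ b 0} eq
... | *≡* a*1≡b*1 = trans (sym (ℤ.*-identityʳ a)) (trans a*1≡b*1 (ℤ.*-identityʳ b))

ℤ⇒ℚ-cancel-≤ : ∀ {a b} → ℤ⇒ℚ a ℚ.≤ ℤ⇒ℚ b → a ℤ.≤ b
ℤ⇒ℚ-cancel-≤ {a} {b} a≤b
  with ℚᵘ.≤-respˡ-≃ (toℚᵘ-ℤ⇒ℚ a) (ℚᵘ.≤-respʳ-≃ (toℚᵘ-ℤ⇒ℚ b) (ℚ.toℚᵘ-mono-≤ a≤b))
... | *≤* a*1≤b*1 = subst₂ ℤ._≤_ (ℤ.*-identityʳ a) (ℤ.*-identityʳ b) a*1≤b*1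

↧*≡↥ : ∀ q → ℤ⇒ℚ (↧ q) ℚ.* q ≡ ℤ⇒ℚ (↥ q)
↧*≡↥ q@(mkℚ n d-1 _) = ℚ.toℚᵘ-injective (begin
  ℚ.toℚᵘ (ℤ⇒ℚ (↧ q) ℚ.* q)               ≈⟨ ℚ.toℚᵘ-homo-* (ℤ⇒ℚ (↧ q)) q ⟩
  ℚ.toℚᵘ (ℤ⇒ℚ (↧ q)) ℚᵘ.* mkℚᵘ n d-1     ≈⟨ ℚᵘ.*-congʳ (toℚᵘ-ℤ⇒ℚ (↧ q)) ⟩
  mkℚᵘ (↧ q) 0 ℚᵘ.* mkℚᵘ n d-1           ≈⟨ *≡* cross-multiply ⟩
  mkℚᵘ n 0                               ≈⟨ toℚᵘ-ℤ⇒ℚ n ⟨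
  ℚ.toℚᵘ (ℤ⇒ℚ (↥ q))                     ∎)
  where
  open ℚᵘ.≃-Reasoning
  cross-multiply : (↧ q ℤ.* n) ℤ.* ℤ.1ℤ ≡ n ℤ.* (+ suc (d-1 ℕ.+ 0))
  cross-multiply = trans (ℤ.*-identityʳ _) (trans (ℤ.*-comm (↧ q) n)
                     (cong (λ e → n ℤ.* + suc e) (sym (ℕ.+-identityʳ d-1))))

-- Geometric sequences of naturals

-- A geometric sequence w of naturals whose ratio is p/s in lowest terms has
-- every power of s dividing w₀: dividing w by s gives another such sequence.
coprime-ratio⇒^∣ : ∀ {s p} .{{_ : NonZero s}} → Coprime s p → ∀ j (w : ℕ → ℕ) →
                   (∀ k → s ℕ.* w (suc k) ≡ p ℕ.* w k) → s ℕ.^ j ∣ w 0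
coprime-ratio⇒^∣         c zero    w rec = 1∣ _
coprime-ratio⇒^∣ {s} {p} c (suc j) w rec =
  subst (s ℕ.^ suc j ∣_) (trans (ℕ.*-comm s (v 0)) (sym (_∣_.equality (s∣w 0))))
    (*-monoʳ-∣ s (coprime-ratio⇒^∣ c j v rec′))
  where
  s∣w : ∀ k → s ∣ w k
  s∣w k = coprime-divisor c (divides (w (suc k)) (trans (sym (rec k)) (ℕ.*-comm s _)))
  v : ℕ → ℕ
  v k = _∣_.quotient (s∣w k)
  rec′ : ∀ k → s ℕ.* v (suc k) ≡ p ℕ.* v k
  rec′ k = ℕ.*-cancelʳ-≡ _ _ s (begin
    s ℕ.* v (suc k) ℕ.* s    ≡⟨ ℕ.*-assoc s _ s ⟩
    s ℕ.* (v (suc k) ℕ.* s)  ≡⟨ cong (s ℕ.*_) (_∣_.equality (s∣w (suc k))) ⟨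
    s ℕ.* w (suc k)          ≡⟨ rec k ⟩
    p ℕ.* w k                ≡⟨ cong (p ℕ.*_) (_∣_.equality (s∣w k)) ⟩
    p ℕ.* (v k ℕ.* s)        ≡⟨ ℕ.*-assoc p _ s ⟨
    p ℕ.* v k ℕ.* s          ∎)
    where open ≡-Reasoning

n<m^n : ∀ {m} → 1 < m → ∀ n → n < m ℕ.^ n
n<m^n 1<m zero    = s≤s z≤n
n<m^n 1<m (suc n) = ℕ.≤-<-trans (n<m^n 1<m n) (ℕ.^-monoʳ-< _ 1<m (ℕ.n<1+n n))

coprime-ratio⇒≡1 : ∀ {s p} .{{_ : NonZero s}} → Coprime s p → (w : ℕ → ℕ) → NonZero (w 0) →
                   (∀ k → s ℕ.* w (suc k) ≡ p ℕ.* w k) → s ≡ 1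
coprime-ratio⇒≡1 {suc zero}        c w w₀≢0 rec = refl
coprime-ratio⇒≡1 {s@(suc (suc _))} c w w₀≢0 rec = contradiction
  (∣⇒≤ {{w₀≢0}} (coprime-ratio⇒^∣ c (w 0) w rec))
  (ℕ.<⇒≱ (n<m^n (s≤s (s≤s z≤n)) (w 0)))

-- The equation in a number field

module RingIdentities (K : NumberField 0ℓ 0ℓ 0ℓ) where

  open NumberField K hiding (refl; sym; trans)
  open HeytingCommutativeRing heytingCommutativeRing using (commutativeRing)
  open NumberField K using () renaming (refl to ≈-refl)
  private
    module F = RingMorphisms.IsRingHomomorphism fromℚ-homo

    fromℚ-morphism : ℚ.+-*-rawRing -Raw-AlmostCommutative⟶ fromCommutativeRing commutativeRing
    fromℚ-morphism = record
      { ⟦_⟧    = fromℚ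
      ; +-homo = F.+-homo
      ; *-homo = F.*-homo
      ; -‿homo = F.-‿homo
      ; 0-homo = F.0#-homo
      ; 1-homo = F.1#-homo
      }
  open Algebra.Solver.Ring ℚ.+-*-rawRing (fromCommutativeRing commutativeRing) fromℚ-morphism
    (λ p q → Maybe.map F.⟦⟧-cong (dec⇒weaklyDec ℚ._≟_ p q))
    using (solve; _:*_; _:+_; :-_; _:=_; con)
  open ≈-Reasoning setoid

  private
    -- The unit, in the form in which the solver evaluates the constant 1.
    𝟏 : Carrier
    𝟏 = fromℚ 1ℚ

  -- One step of Horner's rule for a value e + xp, multiplied by a power y of x and
  -- by a constant c.
  horner-shift : ∀ c e x p y → c * ((e + x * p) * y) + - (e * (c * y)) ≈ c * (p * (x * y))
  horner-shift = solve 5 (λ c e x p y →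
    c :* ((e :+ x :* p) :* y) :+ :- (e :* (c :* y)) := c :* (p :* (x :* y))) ≈-refl

  -- One step of the expansion of ap·bq·(x + y)ᵏ⁺¹ into monomials; p and q are
  -- powers of x and y, and r is (x + y)ᵏ.
  expand-factor : ∀ a b x y p q r →
    (a * (x * p)) * (b * q) * r + (a * p) * (b * (y * q)) * r ≈ (a * p) * (b * q) * ((x + y) * r)
  expand-factor = solve 7 (λ a b x y p q r →
    (a :* (x :* p)) :* (b :* q) :* r :+ (a :* p) :* (b :* (y :* q)) :* r
    := (a :* p) :* (b :* q) :* ((x :+ y) :* r)) ≈-refl

  -- The equation for (α, αβ, αβ²), divided by α².
  ReducedEquation : (d α β : Carrier) → Set
  ReducedEquation d α β = 𝟏 + β * β + β * β * (β * β) ≈ d * α * (β * β * β)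

  -- The coefficients 𝟏 are those of x², y² and z².
  reduce-equation : ∀ d α α⁻¹ β → α * α⁻¹ ≈ 𝟏 →
    𝟏 * (α * α) + 𝟏 * ((α * β) * (α * β)) + 𝟏 * ((α * (β * β)) * (α * (β * β)))
      ≈ d * (α * (α * β) * (α * (β * β))) →
    ReducedEquation d α β
  reduce-equation d α α⁻¹ β αα⁻¹≈1 eq = begin
    𝟏 + β * β + β * β * (β * β)
      ≈⟨ solve 1 (λ β → con 1ℚ :+ β :* β :+ β :* β :* (β :* β)
           := (con 1ℚ :* con 1ℚ) :* (con 1ℚ :+ β :* β :+ β :* β :* (β :* β))) ≈-refl β ⟩
    (𝟏 * 𝟏) * (𝟏 + β * β + β * β * (β * β))
      ≈⟨ *-congʳ (*-cong αα⁻¹≈1 αα⁻¹≈1) ⟨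
    ((α * α⁻¹) * (α * α⁻¹)) * (𝟏 + β * β + β * β * (β * β))
      ≈⟨ solve 3 (λ α γ β → ((α :* γ) :* (α :* γ)) :* (con 1ℚ :+ β :* β :+ β :* β :* (β :* β))
           := (γ :* γ) :* (con 1ℚ :* (α :* α) :+ con 1ℚ :* ((α :* β) :* (α :* β))
                :+ con 1ℚ :* ((α :* (β :* β)) :* (α :* (β :* β))))) ≈-refl α α⁻¹ β ⟩
    (α⁻¹ * α⁻¹) * (𝟏 * (α * α) + 𝟏 * ((α * β) * (α * β)) + 𝟏 * ((α * (β * β)) * (α * (β * β))))
      ≈⟨ *-congˡ eq ⟩
    (α⁻¹ * α⁻¹) * (d * (α * (α * β) * (α * (β * β))))
      ≈⟨ solve 4 (λ d α γ β → (γ :* γ) :* (d :* (α :* (α :* β) :* (α :* (β :* β))))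
           := ((α :* γ) :* (α :* γ)) :* (d :* α :* (β :* β :* β))) ≈-refl d α α⁻¹ β ⟩
    ((α * α⁻¹) * (α * α⁻¹)) * (d * α * (β * β * β))
      ≈⟨ *-congʳ (*-cong αα⁻¹≈1 αα⁻¹≈1) ⟩
    (𝟏 * 𝟏) * (d * α * (β * β * β))
      ≈⟨ solve 1 (λ x → (con 1ℚ :* con 1ℚ) :* x := x) ≈-refl _ ⟩
    d * α * (β * β * β) ∎

  ratio-inverse : ∀ d α β → ReducedEquation d α β →
    β * (d * α * (β * β) + - (β + β * β * β)) ≈ 𝟏
  ratio-inverse d α β eq = begin
    β * (d * α * (β * β) + - (β + β * β * β))
      ≈⟨ solve 3 (λ d α β → β :* (d :* α :* (β :* β) :+ :- (β :+ β :* β :* β))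
           := d :* α :* (β :* β :* β) :+ :- (β :* β :+ β :* β :* (β :* β))) ≈-refl d α β ⟩
    d * α * (β * β * β) + - (β * β + β * β * (β * β))
      ≈⟨ +-congʳ eq ⟨
    𝟏 + β * β + β * β * (β * β) + - (β * β + β * β * (β * β))
      ≈⟨ solve 1 (λ β → con 1ℚ :+ β :* β :+ β :* β :* (β :* β) :+ :- (β :* β :+ β :* β :* (β :* β))
           := con 1ℚ) ≈-refl β ⟩
    𝟏 ∎

  -- Dividing the reduced equation by β² gives dαβ = β² + 1 + β⁻² = (β + β⁻¹)² - 1.
  middle-term : ∀ d α β β⁻¹ → β * β⁻¹ ≈ 𝟏 → ReducedEquation d α β →
    d * (α * β) ≈ (β + β⁻¹) * (β + β⁻¹) + - 𝟏
  middle-term d α β γ βγ≈1 eq = begin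
    d * (α * β)
      ≈⟨ solve 1 (λ x → x := x :* (con 1ℚ :* con 1ℚ)) ≈-refl _ ⟩
    d * (α * β) * (𝟏 * 𝟏)
      ≈⟨ *-congˡ (*-cong βγ≈1 βγ≈1) ⟨
    d * (α * β) * ((β * γ) * (β * γ))
      ≈⟨ solve 4 (λ d α β γ → d :* (α :* β) :* ((β :* γ) :* (β :* γ))
           := d :* α :* (β :* β :* β) :* (γ :* γ)) ≈-refl d α β γ ⟩
    d * α * (β * β * β) * (γ * γ)
      ≈⟨ *-congʳ eq ⟨
    (𝟏 + β * β + β * β * (β * β)) * (γ * γ)
      ≈⟨ solve 2 (λ β γ → (con 1ℚ :+ β :* β :+ β :* β :* (β :* β)) :* (γ :* γ)
           := γ :* γ :+ (con 1ℚ :+ β :* β) :* ((β :* γ) :* (β :* γ))) ≈-refl β γ ⟩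
    γ * γ + (𝟏 + β * β) * ((β * γ) * (β * γ))
      ≈⟨ +-congˡ (*-congˡ (*-cong βγ≈1 βγ≈1)) ⟩
    γ * γ + (𝟏 + β * β) * (𝟏 * 𝟏)
      ≈⟨ solve 2 (λ β γ → γ :* γ :+ (con 1ℚ :+ β :* β) :* (con 1ℚ :* con 1ℚ)
           := (β :+ γ) :* (β :+ γ) :+ con 1ℚ :+ :- (β :* γ :+ β :* γ)) ≈-refl β γ ⟩
    (β + γ) * (β + γ) + 𝟏 + - (β * γ + β * γ)
      ≈⟨ +-congˡ (-‿cong (+-cong βγ≈1 βγ≈1)) ⟩
    (β + γ) * (β + γ) + 𝟏 + - (𝟏 + 𝟏)
      ≈⟨ solve 1 (λ x → x :+ con 1ℚ :+ :- (con 1ℚ :+ con 1ℚ) := x :+ :- con 1ℚ) ≈-refl _ ⟩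
    (β + γ) * (β + γ) + - 𝟏 ∎

-- Arithmetic of the case distinction

p*q≡0⇒q≡0 : ∀ p q .{{_ : ℚ.NonZero p}} → p ℚ.* q ≡ 0ℚ → q ≡ 0ℚ
p*q≡0⇒q≡0 p q pq≡0 = begin
  q                      ≡⟨ ℚ.*-identityˡ q ⟨
  1ℚ ℚ.* q               ≡⟨ cong (ℚ._* q) (ℚ.*-inverseˡ p) ⟨
  ℚ.1/ p ℚ.* p ℚ.* q     ≡⟨ ℚ.*-assoc (ℚ.1/ p) p q ⟩
  ℚ.1/ p ℚ.* (p ℚ.* q)   ≡⟨ cong (ℚ.1/ p ℚ.*_) pq≡0 ⟩
  ℚ.1/ p ℚ.* 0ℚ          ≡⟨ ℚ.*-zeroʳ (ℚ.1/ p) ⟩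
  0ℚ                     ∎
  where open ≡-Reasoning

p*p≡0⇒p≡0 : ∀ p → p ℚ.* p ≡ 0ℚ → p ≡ 0ℚ
p*p≡0⇒p≡0 p p²≡0 with p ℚ.≟ 0ℚ
... | yes p≡0 = p≡0
... | no  p≢0 = p*q≡0⇒q≡0 p p {{ℚ.≢-nonZero p≢0}} p²≡0

p+p≡q+q⇒p≡q : ∀ p q → p ℚ.+ p ≡ q ℚ.+ q → p ≡ q
p+p≡q+q⇒p≡q p q eq = trans (halve p) (trans (cong (½ ℚ.*_) eq) (sym (halve q)))
  where
  open +-*-Solver
  halve : ∀ p → p ≡ ½ ℚ.* (p ℚ.+ p)
  halve = solve 1 (λ p → p := con ½ :* (p :+ p)) refl

-- The integers ±1.
data Sign : ℤ → Set where
  plus  : Sign (+ 1)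
  minus : Sign -[1+ 0 ]

i*i≡1⇒sign : ∀ i → i ℤ.* i ≡ + 1 → Sign i
i*i≡1⇒sign i i²≡1 = abs≡1⇒sign i (ℕ.m*n≡1⇒m≡1 ℤ.∣ i ∣ ℤ.∣ i ∣ (trans (sym (ℤ.abs-* i i)) (cong ℤ.∣_∣ i²≡1)))
  where
  abs≡1⇒sign : ∀ i → ℤ.∣ i ∣ ≡ 1 → Sign i
  abs≡1⇒sign (+ .1)   refl = plus
  abs≡1⇒sign -[1+ 0 ] refl = minus

-- The integers t with t² ≤ 4, according to t² being 0, 1 or 4: the possible
-- traces of an almost integral element of norm 1.
data SmallTrace : ℤ → Set where
  zeroTrace   : SmallTrace (+ 0)
  unitTrace   : ∀ {t} → t ℤ.* t ≡ + 1 → SmallTrace t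
  doubleTrace : ∀ {ε} → Sign ε → SmallTrace (ε ℤ.+ ε)

¬[3+n]²≤4 : ∀ n → ¬ (+ ((3 ℕ.+ n) ℕ.* (3 ℕ.+ n)) ℤ.≤ + 4)
¬[3+n]²≤4 n t²≤4 with ℕ.≤-trans (ℕ.*-mono-≤ (ℕ.m≤m+n 3 n) (ℕ.m≤m+n 3 n)) (ℤ.drop‿+≤+ t²≤4)
... | s≤s (s≤s (s≤s (s≤s ())))

t*t≤4⇒small : ∀ t → t ℤ.* t ℤ.≤ + 4 → SmallTrace t
t*t≤4⇒small (+ 0)      _ = zeroTrace
t*t≤4⇒small (+ 1)      _ = unitTrace refl
t*t≤4⇒small (+ 2)      _ = doubleTrace plus
t*t≤4⇒small -[1+ 0 ]   _ = unitTrace refl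
t*t≤4⇒small -[1+ 1 ]   _ = doubleTrace minus
t*t≤4⇒small (+ (suc (suc (suc n)))) t²≤4 = contradiction t²≤4 (¬[3+n]²≤4 n)
t*t≤4⇒small -[1+ (suc (suc n)) ] t²≤4 = contradiction t²≤4 (¬[3+n]²≤4 n)

d*Y≡3⇒factors : ∀ d Y → + d ℤ.* Y ≡ + 3 → (d ≡ 1 × Y ≡ + 3) ⊎ (d ≡ 3 × Y ≡ + 1)
d*Y≡3⇒factors d (+ n) eq = search d n
  (∣⇒≤ (divides n (trans (sym dn≡3) (ℕ.*-comm d n)))) (∣⇒≤ (divides d (sym dn≡3))) dn≡3
  where
  dn≡3 : d ℕ.* n ≡ 3
  dn≡3 = ℤ.+-injective (trans (ℤ.pos-* d n) eq)
  search : ∀ d n → d ≤ 3 → n ≤ 3 → d ℕ.* n ≡ 3 → (d ≡ 1 × + n ≡ + 3) ⊎ (d ≡ 3 × + n ≡ + 1)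
  search 1 3 _ _ _ = inj₁ (refl , refl)
  search 3 1 _ _ _ = inj₂ (refl , refl)
  search 0 _ _ _ ()
  search 1 0 _ _ ()
  search 1 1 _ _ ()
  search 1 2 _ _ ()
  search 2 0 _ _ ()
  search 2 1 _ _ ()
  search 2 2 _ _ ()
  search 2 3 _ _ ()
  search 3 0 _ _ ()
  search 3 2 _ _ ()
  search 3 3 _ _ ()
  search (suc (suc (suc (suc _)))) _ (s≤s (s≤s (s≤s ())))
  search _ (suc (suc (suc (suc _)))) _ (s≤s (s≤s (s≤s ())))
d*Y≡3⇒factors zero    -[1+ _ ] ()
d*Y≡3⇒factors (suc _) -[1+ _ ] ()

d*Y≡-1⇒factors : ∀ d Y → + d ℤ.* Y ≡ -[1+ 0 ] → d ≡ 1 × Y ≡ -[1+ 0 ]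
d*Y≡-1⇒factors d Y eq with ℕ.m*n≡1⇒m≡1 d ℤ.∣ Y ∣ (trans (sym (ℤ.abs-* (+ d) Y)) (cong ℤ.∣_∣ eq))
... | refl = refl , trans (sym (ℤ.*-identityˡ Y)) eq

-- The ratio ε = ±1 and the middle term Y make (Yε, Y, Yε).
ε-solution∈ : ∀ d Y {ε} → Sign ε → + d ℤ.* Y ≡ + 3 →
              (ℤ⇒ℚ (Y ℤ.* ε) , ℤ⇒ℚ Y , ℤ⇒ℚ (Y ℤ.* ε)) ∈ rationalSolutions d
ε-solution∈ d Y sign dY≡3 with d*Y≡3⇒factors d Y dY≡3 | sign
... | inj₁ (refl , refl) | plus  = here refl
... | inj₁ (refl , refl) | minus = there (here refl)
... | inj₂ (refl , refl) | plus  = here refl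
... | inj₂ (refl , refl) | minus = there (here refl)

rationalSolutions⊆ : ∀ d {t} → t ∈ rationalSolutions d → 𝓖𝓟₁₁₁ ℚ-numberField d t
rationalSolutions⊆ 1 (here refl) =
    (fromℤ-integral (+ 3) , fromℤ-integral (+ 3) , fromℤ-integral (+ 3))
  , (ℤ⇒𝓞 (+ 3) , ℤ⇒𝓞 (+ 1) , (refl , refl , refl) , λ ()) , refl
  where open NumberField ℚ-numberField using (ℤ⇒𝓞; fromℤ-integral)
rationalSolutions⊆ 1 (there (here refl)) =
    (fromℤ-integral -[1+ 2 ] , fromℤ-integral (+ 3) , fromℤ-integral -[1+ 2 ])
  , (ℤ⇒𝓞 -[1+ 2 ] , ℤ⇒𝓞 -[1+ 0 ] , (refl , refl , refl) , λ ()) , refl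
  where open NumberField ℚ-numberField using (ℤ⇒𝓞; fromℤ-integral)
rationalSolutions⊆ 3 (here refl) =
    (fromℤ-integral (+ 1) , fromℤ-integral (+ 1) , fromℤ-integral (+ 1))
  , (ℤ⇒𝓞 (+ 1) , ℤ⇒𝓞 (+ 1) , (refl , refl , refl) , λ ()) , refl
  where open NumberField ℚ-numberField using (ℤ⇒𝓞; fromℤ-integral)
rationalSolutions⊆ 3 (there (here refl)) =
    (fromℤ-integral -[1+ 0 ] , fromℤ-integral (+ 1) , fromℤ-integral -[1+ 0 ])
  , (ℤ⇒𝓞 -[1+ 0 ] , ℤ⇒𝓞 -[1+ 0 ] , (refl , refl , refl) , λ ()) , refl
  where open NumberField ℚ-numberField using (ℤ⇒𝓞; fromℤ-integral)

-- The order ℤ[√-D]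

module QuadraticIntegers (D : ℕ) .{{_ : NonZero D}} where

  open QuadraticField D
  open RingMorphisms.IsRingHomomorphism ι-homo using () renaming (*-homo to ι-*)
  open Exp (CommutativeRing.commutativeSemiring commutativeRing) using (_^_; ^-distrib-*; ^-homo-*)
  open CommutativeRing commutativeRing using (zeroˡ; zeroʳ)

  open RingIdentities ℚ[√- D ]

  -- The embedding of ℤ in K.
  int : ℤ → K
  int z = ι (ℤ⇒ℚ z)

  int-+ : ∀ a b → int (a ℤ.+ b) ≡ int a ⊕ int b
  int-+ a b = cong ι (ℤ⇒ℚ-+ a b)

  int-* : ∀ a b → int (a ℤ.* b) ≡ int a ⊗ int b
  int-* a b = trans (cong ι (ℤ⇒ℚ-* a b)) (ι-* (ℤ⇒ℚ a) (ℤ⇒ℚ b))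

  ι-⊗ : ∀ q a b → ι q ⊗ ⟨ a , b ⟩ ≡ ⟨ q ℚ.* a , q ℚ.* b ⟩
  ι-⊗ q a b = cong₂ ⟨_,_⟩
    (solve 4 (λ q a b D → q :* a :- D :* (con 0ℚ :* b) := q :* a) refl q a b δ)
    (solve 3 (λ q a b → q :* b :+ con 0ℚ :* a := q :* b) refl q a b)
    where open +-*-Solver

  -- ℤ[√-D], as the property of having integer coordinates.
  Lattice : K → Set
  Lattice x = ∃[ u ] ∃[ v ] x ≡ ⟨ ℤ⇒ℚ u , ℤ⇒ℚ v ⟩

  int∈Lattice : ∀ z → Lattice (int z)
  int∈Lattice z = z , + 0 , refl

  √-D∈Lattice : Lattice √-D
  √-D∈Lattice = + 0 , + 1 , refl

  ⊕∈Lattice : ∀ {x y} → Lattice x → Lattice y → Lattice (x ⊕ y)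
  ⊕∈Lattice (u , v , refl) (u′ , v′ , refl) =
    u ℤ.+ u′ , v ℤ.+ v′ , cong₂ ⟨_,_⟩ (sym (ℤ⇒ℚ-+ u u′)) (sym (ℤ⇒ℚ-+ v v′))

  ⊖∈Lattice : ∀ {x} → Lattice x → Lattice (⊖ x)
  ⊖∈Lattice (u , v , refl) =
    ℤ.- u , ℤ.- v , cong₂ ⟨_,_⟩ (sym (ℤ⇒ℚ-neg u)) (sym (ℤ⇒ℚ-neg v))

  ⊗∈Lattice : ∀ {x y} → Lattice x → Lattice y → Lattice (x ⊗ y)
  ⊗∈Lattice (u , v , refl) (u′ , v′ , refl) =
      u ℤ.* u′ ℤ.- + D ℤ.* (v ℤ.* v′) , u ℤ.* v′ ℤ.+ v ℤ.* u′
    , cong₂ ⟨_,_⟩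
        (sym (trans (ℤ⇒ℚ-+ (u ℤ.* u′) _) (cong₂ ℚ._+_ (ℤ⇒ℚ-* u u′)
          (trans (ℤ⇒ℚ-neg (+ D ℤ.* (v ℤ.* v′))) (cong ℚ.-_
            (trans (ℤ⇒ℚ-* (+ D) (v ℤ.* v′)) (cong (δ ℚ.*_) (ℤ⇒ℚ-* v v′))))))))
        (sym (trans (ℤ⇒ℚ-+ (u ℤ.* v′) _) (cong₂ ℚ._+_ (ℤ⇒ℚ-* u v′) (ℤ⇒ℚ-* v u′))))

  ^∈Lattice : ∀ {x} → Lattice x → ∀ k → Lattice (x ^ k)
  ^∈Lattice x∈L zero    = int∈Lattice (+ 1)
  ^∈Lattice x∈L (suc k) = ⊗∈Lattice x∈L (^∈Lattice x∈L k)

  common-denominator : ∀ x → ∃[ w ] NonZero w × Lattice (int (+ w) ⊗ x)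
  common-denominator ⟨ a , b ⟩ = ↧ₙ a ℕ.* ↧ₙ b , _ , ↥ a ℤ.* ↧ b , ↧ a ℤ.* ↥ b , (begin
    int (+ (↧ₙ a ℕ.* ↧ₙ b)) ⊗ ⟨ a , b ⟩  ≡⟨ cong (λ z → int z ⊗ ⟨ a , b ⟩) (ℤ.pos-* (↧ₙ a) (↧ₙ b)) ⟩
    int (↧ a ℤ.* ↧ b) ⊗ ⟨ a , b ⟩        ≡⟨ ι-⊗ (ℤ⇒ℚ (↧ a ℤ.* ↧ b)) a b ⟩
    ⟨ ℤ⇒ℚ (↧ a ℤ.* ↧ b) ℚ.* a , ℤ⇒ℚ (↧ a ℤ.* ↧ b) ℚ.* b ⟩
      ≡⟨ cong (λ q → ⟨ q ℚ.* a , q ℚ.* b ⟩) (ℤ⇒ℚ-* (↧ a) (↧ b)) ⟩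
    ⟨ ℤ⇒ℚ (↧ a) ℚ.* ℤ⇒ℚ (↧ b) ℚ.* a , ℤ⇒ℚ (↧ a) ℚ.* ℤ⇒ℚ (↧ b) ℚ.* b ⟩
      ≡⟨ cong₂ ⟨_,_⟩
           (solve 3 (λ m n a → m :* n :* a := (m :* a) :* n) refl (ℤ⇒ℚ (↧ a)) (ℤ⇒ℚ (↧ b)) a)
           (ℚ.*-assoc (ℤ⇒ℚ (↧ a)) _ _) ⟩
    ⟨ (ℤ⇒ℚ (↧ a) ℚ.* a) ℚ.* ℤ⇒ℚ (↧ b) , ℤ⇒ℚ (↧ a) ℚ.* (ℤ⇒ℚ (↧ b) ℚ.* b) ⟩
      ≡⟨ cong₂ (λ p q → ⟨ p ℚ.* ℤ⇒ℚ (↧ b) , ℤ⇒ℚ (↧ a) ℚ.* q ⟩) (↧*≡↥ a) (↧*≡↥ b) ⟩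
    ⟨ ℤ⇒ℚ (↥ a) ℚ.* ℤ⇒ℚ (↧ b) , ℤ⇒ℚ (↧ a) ℚ.* ℤ⇒ℚ (↥ b) ⟩
      ≡⟨ cong₂ ⟨_,_⟩ (ℤ⇒ℚ-* (↥ a) (↧ b)) (ℤ⇒ℚ-* (↧ a) (↥ b)) ⟨
    ⟨ ℤ⇒ℚ (↥ a ℤ.* ↧ b) , ℤ⇒ℚ (↧ a ℤ.* ↥ b) ⟩ ∎)
    where
    open ≡-Reasoning
    open +-*-Solver

  -- Almost integral elements

  -- x is almost integral when its powers have a common denominator over ℤ[√-D].
  AlmostIntegral : K → Set
  AlmostIntegral x = ∃[ m ] NonZero m × ∀ k → Lattice (int (+ m) ⊗ x ^ k)

  -- The evaluation of a monic polynomial over ℤ by Horner's rule, written with the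
  -- operations of K; the coefficient list is encoded as for evalMonic.
  horner : List ℤ → K → K
  horner []       x = 𝟙
  horner (c ∷ cs) x = int c ⊕ x ⊗ horner cs x

  evalMonic≡horner : ∀ cs x → NumberField.evalMonic ℚ[√- D ] cs x ≡ horner cs x
  evalMonic≡horner []       x = refl
  evalMonic≡horner (c ∷ cs) x = cong (λ p → int c ⊕ x ⊗ p) (evalMonic≡horner cs x)

  -- If c clears the denominators of xʲ, …, xʲ⁺ⁿ⁻¹ and of p(x)xʲ, where p is
  -- monic of degree n over ℤ, then it clears that of xʲ⁺ⁿ.
  clears-next-power : ∀ c x cs j → Lattice (c ⊗ (horner cs x ⊗ x ^ j)) →
                      (∀ i → i < length cs → Lattice (c ⊗ x ^ (i ℕ.+ j))) →
                      Lattice (c ⊗ x ^ (length cs ℕ.+ j))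
  clears-next-power c x []       j top low = subst Lattice (cong (c ⊗_) (⊗-identityˡ _)) top
  clears-next-power c x (e ∷ es) j top low = subst (λ n → Lattice (c ⊗ x ^ n)) (ℕ.+-suc (length es) j)
    (clears-next-power c x es (suc j)
      (subst Lattice
        (horner-shift c (int e) x (horner es x) (x ^ j))
        (⊕∈Lattice top (⊖∈Lattice (⊗∈Lattice (int∈Lattice e) (low 0 (s≤s z≤n))))))
      (λ i i<n → subst (λ n → Lattice (c ⊗ x ^ n)) (sym (ℕ.+-suc i j)) (low (suc i) (s≤s i<n))))

  -- Write x = y/w with y in ℤ[√-D].  Then wⁿ clears the denominators of x⁰, …, xⁿ,
  -- and the monic equation of degree n propagates this to all powers.
  root⇒almostIntegral : ∀ {x} → ∃[ cs ] horner cs x ≡ 𝟘 → AlmostIntegral x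
  root⇒almostIntegral {x} (cs , px≡0) = w ℕ.^ n , ℕ.m^n≢0 w n , λ k → window k 0 z≤n
    where
    n = length cs
    w = proj₁ (common-denominator x)
    wx∈L = proj₂ (proj₂ (common-denominator x))
    instance
      w≢0 : NonZero w
      w≢0 = proj₁ (proj₂ (common-denominator x))
    c = int (+ (w ℕ.^ n))

    int-^ : ∀ k → int (+ (w ℕ.^ k)) ≡ int (+ w) ^ k
    int-^ zero    = refl
    int-^ (suc k) = trans (cong int (ℤ.pos-* w (w ℕ.^ k)))
      (trans (int-* (+ w) (+ (w ℕ.^ k))) (cong (int (+ w) ⊗_) (int-^ k)))

    -- wⁿxⁱ = wⁿ⁻ⁱ(wx)ⁱ
    low : ∀ i → i ≤ n → Lattice (c ⊗ x ^ i)
    low i i≤n = subst Lattice (begin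
      int (+ w) ^ (n ℕ.∸ i) ⊗ (int (+ w) ⊗ x) ^ i           ≡⟨ cong (int (+ w) ^ (n ℕ.∸ i) ⊗_) (^-distrib-* (int (+ w)) x i) ⟩
      int (+ w) ^ (n ℕ.∸ i) ⊗ (int (+ w) ^ i ⊗ x ^ i)       ≡⟨ ⊗-assoc (int (+ w) ^ (n ℕ.∸ i)) _ _ ⟨
      int (+ w) ^ (n ℕ.∸ i) ⊗ int (+ w) ^ i ⊗ x ^ i         ≡⟨ cong (_⊗ x ^ i) (^-homo-* (int (+ w)) (n ℕ.∸ i) i) ⟨
      int (+ w) ^ (n ℕ.∸ i ℕ.+ i) ⊗ x ^ i                   ≡⟨ cong (λ e → int (+ w) ^ e ⊗ x ^ i) (ℕ.m∸n+n≡m i≤n) ⟩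
      int (+ w) ^ n ⊗ x ^ i                                 ≡⟨ cong (_⊗ x ^ i) (int-^ n) ⟨
      c ⊗ x ^ i                                             ∎)
      (⊗∈Lattice (^∈Lattice (int∈Lattice (+ w)) (n ℕ.∸ i)) (^∈Lattice wx∈L i))
      where open ≡-Reasoning

    -- The n + 1 consecutive powers from xᵏ on.
    window : ∀ k i → i ≤ n → Lattice (c ⊗ x ^ (i ℕ.+ k))
    window zero    i i≤n = subst (λ e → Lattice (c ⊗ x ^ e)) (sym (ℕ.+-identityʳ i)) (low i i≤n)
    window (suc k) i i≤n with ℕ.m≤n⇒m<n∨m≡n i≤n
    ... | inj₁ i<n  = subst (λ e → Lattice (c ⊗ x ^ e)) (sym (ℕ.+-suc i k)) (window k (suc i) i<n)
    ... | inj₂ refl = clears-next-power c x cs (suc k)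
      (subst Lattice
        (sym (trans (cong (λ p → c ⊗ (p ⊗ x ^ suc k)) px≡0)
          (trans (cong (c ⊗_) (zeroˡ (x ^ suc k))) (zeroʳ c))))
        (int∈Lattice (+ 0)))
      (λ i i<n → subst (λ e → Lattice (c ⊗ x ^ e)) (sym (ℕ.+-suc i k)) (window k (suc i) i<n))

  integral⇒almostIntegral : ∀ {x} → NumberField.Integral ℚ[√- D ] x → AlmostIntegral x
  integral⇒almostIntegral {x} (cs , px≡0) = root⇒almostIntegral (cs , trans (sym (evalMonic≡horner cs x)) px≡0)

  open RingProperties (CommutativeRing.ring commutativeRing) using (-1*x≈-x)
  open CommutativeSemigroupProperties (CommutativeRing.*-commutativeSemigroup commutativeRing) using (x∙yz≈y∙xz; interchange)

  lattice⇒almostIntegral : ∀ {x} → Lattice x → AlmostIntegral x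
  lattice⇒almostIntegral x∈L = 1 , _ , λ k → ⊗∈Lattice (int∈Lattice (+ 1)) (^∈Lattice x∈L k)

  int-pos-* : ∀ m n → int (+ m) ⊗ int (+ n) ≡ int (+ (m ℕ.* n))
  int-pos-* m n = sym (trans (cong int (ℤ.pos-* m n)) (int-* (+ m) (+ n)))

  ⊗-almostIntegral : ∀ {x y} → AlmostIntegral x → AlmostIntegral y → AlmostIntegral (x ⊗ y)
  ⊗-almostIntegral {x} {y} (m , m≢0 , mxᵏ∈L) (n , n≢0 , nyᵏ∈L) =
    m ℕ.* n , ℕ.m*n≢0 m n {{m≢0}} {{n≢0}} , λ k → subst Lattice
      (trans (interchange (int (+ m)) (x ^ k) (int (+ n)) (y ^ k))
        (cong₂ _⊗_ (int-pos-* m n) (sym (^-distrib-* x y k))))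
      (⊗∈Lattice (mxᵏ∈L k) (nyᵏ∈L k))

  ⊕-almostIntegral : ∀ {x y} → AlmostIntegral x → AlmostIntegral y → AlmostIntegral (x ⊕ y)
  ⊕-almostIntegral {x} {y} (m , m≢0 , mxᵏ∈L) (n , n≢0 , nyᵏ∈L) =
    m ℕ.* n , ℕ.m*n≢0 m n {{m≢0}} {{n≢0}} , λ k → subst Lattice
      (cong (_⊗ (x ⊕ y) ^ k)
        (trans (cong₂ _⊗_ (⊗-identityʳ (int (+ m))) (⊗-identityʳ (int (+ n)))) (int-pos-* m n)))
      (mixed k 0 0)
    where
    -- Expanding one factor of (x + y)ᵏ at a time replaces the binomial theorem.
    mixed : ∀ k i j → Lattice ((int (+ m) ⊗ x ^ i) ⊗ (int (+ n) ⊗ y ^ j) ⊗ (x ⊕ y) ^ k)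
    mixed zero    i j = ⊗∈Lattice (⊗∈Lattice (mxᵏ∈L i) (nyᵏ∈L j)) (int∈Lattice (+ 1))
    mixed (suc k) i j = subst Lattice
      (expand-factor (int (+ m)) (int (+ n)) x y (x ^ i) (y ^ j) ((x ⊕ y) ^ k))
      (⊕∈Lattice (mixed k (suc i) j) (mixed k i (suc j)))

  ⊖-almostIntegral : ∀ {x} → AlmostIntegral x → AlmostIntegral (⊖ x)
  ⊖-almostIntegral {x} x∈A = subst AlmostIntegral (-1*x≈-x x)
    (⊗-almostIntegral (lattice⇒almostIntegral (⊖∈Lattice (int∈Lattice (+ 1)))) x∈A)

  int-almostIntegral : ∀ z → AlmostIntegral (int z)
  int-almostIntegral z = lattice⇒almostIntegral (int∈Lattice z)

  -- Conjugation, norm and trace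

  -- a + b√-D ↦ a - b√-D
  conj : K → K
  conj ⟨ a , b ⟩ = ⟨ a , ℚ.- b ⟩

  conj-⊗ : ∀ x y → conj (x ⊗ y) ≡ conj x ⊗ conj y
  conj-⊗ ⟨ a , b ⟩ ⟨ c , d ⟩ = cong₂ ⟨_,_⟩
    (solve 5 (λ a b c d D → a :* c :- D :* (b :* d) := a :* c :- D :* ((:- b) :* (:- d))) refl a b c d δ)
    (solve 4 (λ a b c d → :- (a :* d :+ b :* c) := a :* (:- d) :+ (:- b) :* c) refl a b c d)
    where open +-*-Solver

  conj-^ : ∀ x k → conj (x ^ k) ≡ conj x ^ k
  conj-^ x zero    = refl
  conj-^ x (suc k) = trans (conj-⊗ x (x ^ k)) (cong (conj x ⊗_) (conj-^ x k))

  conj∈Lattice : ∀ {x} → Lattice x → Lattice (conj x)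
  conj∈Lattice (u , v , refl) = u , ℤ.- v , cong ⟨ ℤ⇒ℚ u ,_⟩ (sym (ℤ⇒ℚ-neg v))

  conj-almostIntegral : ∀ {x} → AlmostIntegral x → AlmostIntegral (conj x)
  conj-almostIntegral {x} (m , m≢0 , mxᵏ∈L) = m , m≢0 , λ k → subst Lattice
    (trans (conj-⊗ (int (+ m)) (x ^ k)) (cong (int (+ m) ⊗_) (conj-^ x k)))
    (conj∈Lattice (mxᵏ∈L k))

  x⊗conj : ∀ x → x ⊗ conj x ≡ ι (norm x)
  x⊗conj ⟨ a , b ⟩ = cong₂ ⟨_,_⟩
    (solve 3 (λ a b D → a :* a :- D :* (b :* (:- b)) := a :* a :+ D :* (b :* b)) refl a b δ)
    (solve 2 (λ a b → a :* (:- b) :+ b :* a := con 0ℚ) refl a b)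
    where open +-*-Solver

  x⊕conj : ∀ a b → ⟨ a , b ⟩ ⊕ conj ⟨ a , b ⟩ ≡ ι (a ℚ.+ a)
  x⊕conj a b = cong ⟨ a ℚ.+ a ,_⟩ (ℚ.+-inverseʳ b)

  -- ℤ is completely integrally closed: the integers m·qᵏ form a geometric sequence
  -- of ratio q, which forces the denominator of q to be 1.
  rational-almostIntegral : ∀ {q} → AlmostIntegral (ι q) → ∃[ z ] q ≡ ℤ⇒ℚ z
  rational-almostIntegral {q@(mkℚ _ _ c)} (m , m≢0 , mqᵏ∈L) = ↥ q , (begin
    q                    ≡⟨ ℚ.*-identityˡ q ⟨
    ℤ⇒ℚ (+ 1) ℚ.* q      ≡⟨ cong (λ n → ℤ⇒ℚ (+ n) ℚ.* q) ↧≡1 ⟨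
    ℤ⇒ℚ (↧ q) ℚ.* q      ≡⟨ ↧*≡↥ q ⟩
    ℤ⇒ℚ (↥ q)            ∎)
    where
    open ≡-Reasoning
    -- zₖ = m·qᵏ
    z : ℕ → ℤ
    z k = proj₁ (mqᵏ∈L k)

    z-eq : ∀ k → Quadratic.ratPart (int (+ m) ⊗ ι q ^ k) ≡ ℤ⇒ℚ (z k)
    z-eq k = cong Quadratic.ratPart (proj₂ (proj₂ (mqᵏ∈L k)))

    z₀≡m : z 0 ≡ + m
    z₀≡m = ℤ⇒ℚ-injective (trans (sym (z-eq 0)) (cong Quadratic.ratPart (⊗-identityʳ (int (+ m)))))

    step : ∀ k → ℤ⇒ℚ (z (suc k)) ≡ q ℚ.* ℤ⇒ℚ (z k)
    step k = begin
      ℤ⇒ℚ (z (suc k))                                     ≡⟨ z-eq (suc k) ⟨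
      Quadratic.ratPart (int (+ m) ⊗ (ι q ⊗ ι q ^ k))
        ≡⟨ cong Quadratic.ratPart (x∙yz≈y∙xz (int (+ m)) (ι q) (ι q ^ k)) ⟩
      Quadratic.ratPart (ι q ⊗ (int (+ m) ⊗ ι q ^ k))     ≡⟨ cong Quadratic.ratPart
        (ι-⊗ q (Quadratic.ratPart (int (+ m) ⊗ ι q ^ k)) (Quadratic.√Part (int (+ m) ⊗ ι q ^ k))) ⟩
      q ℚ.* Quadratic.ratPart (int (+ m) ⊗ ι q ^ k)       ≡⟨ cong (q ℚ.*_) (z-eq k) ⟩
      q ℚ.* ℤ⇒ℚ (z k)                                     ∎

    step-ℤ : ∀ k → ↧ q ℤ.* z (suc k) ≡ ↥ q ℤ.* z k
    step-ℤ k = ℤ⇒ℚ-injective (begin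
      ℤ⇒ℚ (↧ q ℤ.* z (suc k))                 ≡⟨ ℤ⇒ℚ-* (↧ q) (z (suc k)) ⟩
      ℤ⇒ℚ (↧ q) ℚ.* ℤ⇒ℚ (z (suc k))           ≡⟨ cong (ℤ⇒ℚ (↧ q) ℚ.*_) (step k) ⟩
      ℤ⇒ℚ (↧ q) ℚ.* (q ℚ.* ℤ⇒ℚ (z k))         ≡⟨ ℚ.*-assoc (ℤ⇒ℚ (↧ q)) q _ ⟨
      ℤ⇒ℚ (↧ q) ℚ.* q ℚ.* ℤ⇒ℚ (z k)           ≡⟨ cong (ℚ._* ℤ⇒ℚ (z k)) (↧*≡↥ q) ⟩
      ℤ⇒ℚ (↥ q) ℚ.* ℤ⇒ℚ (z k)                 ≡⟨ ℤ⇒ℚ-* (↥ q) (z k) ⟨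
      ℤ⇒ℚ (↥ q ℤ.* z k)                       ∎)

    ↧≡1 : ↧ₙ q ≡ 1
    ↧≡1 = coprime-ratio⇒≡1 (Coprimality.sym (Coprimality.recompute c)) (λ k → ℤ.∣ z k ∣)
      (subst (λ e → NonZero ℤ.∣ e ∣) (sym z₀≡m) m≢0)
      (λ k → trans (sym (ℤ.abs-* (↧ q) (z (suc k)))) (trans (cong ℤ.∣_∣ (step-ℤ k)) (ℤ.abs-* (↥ q) (z k))))

  norm-integer : ∀ {x} → AlmostIntegral x → ∃[ n ] norm x ≡ ℤ⇒ℚ n
  norm-integer {x} x∈A = rational-almostIntegral
    (subst AlmostIntegral (x⊗conj x) (⊗-almostIntegral x∈A (conj-almostIntegral x∈A)))

  trace-integer : ∀ {x} → AlmostIntegral x → ∃[ t ] x ⊕ conj x ≡ int t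
  trace-integer {x@(⟨ a , b ⟩)} x∈A =
    let t , eq = rational-almostIntegral
          (subst AlmostIntegral (x⊕conj a b) (⊕-almostIntegral x∈A (conj-almostIntegral x∈A)))
    in t , trans (x⊕conj a b) (cong ι eq)

  norm-⊗ : ∀ x y → norm (x ⊗ y) ≡ norm x ℚ.* norm y
  norm-⊗ ⟨ a , b ⟩ ⟨ c , d ⟩ = solve 5 (λ a b c d D →
    (a :* c :- D :* (b :* d)) :* (a :* c :- D :* (b :* d)) :+ D :* ((a :* d :+ b :* c) :* (a :* d :+ b :* c))
    := (a :* a :+ D :* (b :* b)) :* (c :* c :+ D :* (d :* d))) refl a b c d δ
    where open +-*-Solver

  nonNegative-norm : ∀ x → ℚ.NonNegative (norm x)
  nonNegative-norm ⟨ a , b ⟩ = ℚ.nonNeg+nonNeg⇒nonNeg (a ℚ.* a) {{nonNegative-square a}} (δ ℚ.* (b ℚ.* b))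
    {{ℚ.nonNeg*nonNeg⇒nonNeg δ {{ℚ.pos⇒nonNeg δ {{positive-δ}}}} (b ℚ.* b) {{nonNegative-square b}}}}

  norm-𝟙 : norm 𝟙 ≡ 1ℚ
  norm-𝟙 = trans (cong (1ℚ ℚ.+_) (ℚ.*-zeroʳ δ)) (ℚ.+-identityʳ 1ℚ)

  nonNegative-unit : ∀ m → ℚ.NonNegative (ℤ⇒ℚ m) → ℤ.∣ m ∣ ≡ 1 → m ≡ + 1
  nonNegative-unit (+ .1)   _  refl = refl
  nonNegative-unit -[1+ 0 ] () refl

  -- The norms of x and y are nonnegative integers with product 1.
  unit⇒norm≡1 : ∀ {x y} → AlmostIntegral x → AlmostIntegral y → x ⊗ y ≡ 𝟙 → norm x ≡ 1ℚ
  unit⇒norm≡1 {x} {y} x∈A y∈A xy≡1 = trans Nx≡m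
    (cong ℤ⇒ℚ (nonNegative-unit m (subst ℚ.NonNegative Nx≡m (nonNegative-norm x)) ∣m∣≡1))
    where
    open ≡-Reasoning
    m n : ℤ
    m = proj₁ (norm-integer x∈A)
    n = proj₁ (norm-integer y∈A)
    Nx≡m : norm x ≡ ℤ⇒ℚ m
    Nx≡m = proj₂ (norm-integer x∈A)
    Ny≡n : norm y ≡ ℤ⇒ℚ n
    Ny≡n = proj₂ (norm-integer y∈A)
    ℤ⇒ℚmn≡1 : ℤ⇒ℚ (m ℤ.* n) ≡ ℤ⇒ℚ (+ 1)
    ℤ⇒ℚmn≡1 = begin
      ℤ⇒ℚ (m ℤ.* n)            ≡⟨ ℤ⇒ℚ-* m n ⟩
      ℤ⇒ℚ m ℚ.* ℤ⇒ℚ n          ≡⟨ cong₂ ℚ._*_ Nx≡m Ny≡n ⟨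
      norm x ℚ.* norm y        ≡⟨ norm-⊗ x y ⟨
      norm (x ⊗ y)             ≡⟨ cong norm xy≡1 ⟩
      norm 𝟙                   ≡⟨ norm-𝟙 ⟩
      1ℚ                       ∎
    mn≡1 : m ℤ.* n ≡ + 1
    mn≡1 = ℤ⇒ℚ-injective ℤ⇒ℚmn≡1
    ∣m∣≡1 : ℤ.∣ m ∣ ≡ 1
    ∣m∣≡1 = ℕ.m*n≡1⇒m≡1 ℤ.∣ m ∣ ℤ.∣ n ∣ (trans (sym (ℤ.abs-* m n)) (cong ℤ.∣_∣ mn≡1))

  -- Solutions in terms of the unit β

  d⊗y≡int⇒rational : ∀ {d} .{{_ : NonZero d}} {y n} → int (+ d) ⊗ y ≡ int n → y ≡ ι (Quadratic.ratPart y)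
  d⊗y≡int⇒rational {d} {⟨ a , b ⟩} dy≡n = cong ⟨ a ,_⟩
    (p*q≡0⇒q≡0 (ℤ⇒ℚ (+ d)) b {{ℚ.pos⇒nonZero (ℤ⇒ℚ (+ d)) {{ℚ.normalize-pos d 1}}}}
      (cong Quadratic.√Part (trans (sym (ι-⊗ (ℤ⇒ℚ (+ d)) a b)) dy≡n)))

  -- The data of a solution t in terms of its ratio β, the trace T of β and the
  -- middle term Y of t; since β has norm 1, the first term Y/β is Y times the
  -- conjugate of β.
  record UnitForm (d : ℕ) (t : NumberField.Triple ℚ[√- D ]) : Set where
    field
      β           : K
      Y T         : ℤ
      β-integral  : AlmostIntegral β
      norm≡1      : norm β ≡ 1ℚ
      trace≡T     : β ⊕ conj β ≡ int T
      dY≡T²-1     : + d ℤ.* Y ≡ T ℤ.* T ℤ.- + 1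
      Y≢0         : Y ≢ + 0
      triple      : t ≡ (int Y ⊗ conj β , int Y , int Y ⊗ β)

  norm≡1⇒inverse : ∀ x → norm x ≡ 1ℚ → x ⊗ conj x ≡ 𝟙
  norm≡1⇒inverse x Nx≡1 = trans (x⊗conj x) (cong ι Nx≡1)

  d⊗αβ≡T²-1 : ∀ d α β T → norm β ≡ 1ℚ → β ⊕ conj β ≡ int T → ReducedEquation (int d) α β →
              int d ⊗ (α ⊗ β) ≡ int (T ℤ.* T ℤ.- + 1)
  d⊗αβ≡T²-1 d α β T Nβ≡1 trace≡T reduced = begin
    int d ⊗ (α ⊗ β)                           ≡⟨ middle-term (int d) α β (conj β) (norm≡1⇒inverse β Nβ≡1) reduced ⟩
    (β ⊕ conj β) ⊗ (β ⊕ conj β) ⊕ ⊖ 𝟙         ≡⟨ cong (λ τ → τ ⊗ τ ⊕ ⊖ 𝟙) trace≡T ⟩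
    int T ⊗ int T ⊕ ⊖ 𝟙                       ≡⟨ cong (_⊕ ⊖ 𝟙) (int-* T T) ⟨
    int (T ℤ.* T) ⊕ ⊖ 𝟙                       ≡⟨ int-+ (T ℤ.* T) -[1+ 0 ] ⟨
    int (T ℤ.* T ℤ.- + 1)                     ∎
    where open ≡-Reasoning

  α≡αβ⊗conj : ∀ α β → norm β ≡ 1ℚ → α ≡ α ⊗ β ⊗ conj β
  α≡αβ⊗conj α β Nβ≡1 = begin
    α                      ≡⟨ ⊗-identityʳ α ⟨
    α ⊗ 𝟙                  ≡⟨ cong (α ⊗_) (norm≡1⇒inverse β Nβ≡1) ⟨
    α ⊗ (β ⊗ conj β)       ≡⟨ ⊗-assoc α β (conj β) ⟨
    α ⊗ β ⊗ conj β         ∎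
    where open ≡-Reasoning

  ratio-norm≡1 : ∀ d α β → AlmostIntegral α → AlmostIntegral β →
                 ReducedEquation (int d) α β → norm β ≡ 1ℚ
  ratio-norm≡1 d α β α∈A β∈A reduced = unit⇒norm≡1 β∈A
    (⊕-almostIntegral
      (⊗-almostIntegral (⊗-almostIntegral (int-almostIntegral d) α∈A) (⊗-almostIntegral β∈A β∈A))
      (⊖-almostIntegral (⊕-almostIntegral β∈A (⊗-almostIntegral (⊗-almostIntegral β∈A β∈A) β∈A))))
    (ratio-inverse (int d) α β reduced)

  middle-integer : ∀ {d y n} .{{_ : NonZero d}} → AlmostIntegral y → int (+ d) ⊗ y ≡ int n →
                   ∃[ Y ] y ≡ int Y × + d ℤ.* Y ≡ n
  middle-integer {d} {y} {n} y∈A dy≡n = conclude (rational-almostIntegral (subst AlmostIntegral y-rational y∈A))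
    where
    y-rational : y ≡ ι (Quadratic.ratPart y)
    y-rational = d⊗y≡int⇒rational {d} {y} {n} dy≡n

    conclude : (∃[ Y ] Quadratic.ratPart y ≡ ℤ⇒ℚ Y) → ∃[ Y ] y ≡ int Y × + d ℤ.* Y ≡ n
    conclude (Y , a≡Y) = Y , y≡Y , ℤ⇒ℚ-injective (cong Quadratic.ratPart
      (trans (int-* (+ d) Y) (trans (cong (int (+ d) ⊗_) (sym y≡Y)) dy≡n)))
      where
      y≡Y : y ≡ int Y
      y≡Y = trans y-rational (cong ι a≡Y)

  unitForm : ∀ d .{{_ : NonZero d}} α β → AlmostIntegral β → norm β ≡ 1ℚ → α ≢ 𝟘 →
             ∀ T → β ⊕ conj β ≡ int T →
             ∃[ Y ] α ⊗ β ≡ int Y × + d ℤ.* Y ≡ T ℤ.* T ℤ.- + 1 →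
             UnitForm d (α , α ⊗ β , α ⊗ (β ⊗ β))
  unitForm d α β β∈A Nβ≡1 α≢0 T trace≡T (Y , αβ≡Y , dY≡T²-1) = record
    { β          = β
    ; Y          = Y
    ; T          = T
    ; β-integral = β∈A
    ; norm≡1     = Nβ≡1
    ; trace≡T    = trace≡T
    ; dY≡T²-1    = dY≡T²-1
    ; Y≢0        = λ Y≡0 → α≢0 (trans α≡Yβ̄ (trans (cong (λ Y → int Y ⊗ conj β) Y≡0) (zeroˡ (conj β))))
    ; triple     = cong₂ _,_ α≡Yβ̄ (cong₂ _,_ αβ≡Y
                     (trans (sym (⊗-assoc α β β)) (cong (_⊗ β) αβ≡Y)))
    }
    where
    α≡Yβ̄ : α ≡ int Y ⊗ conj β
    α≡Yβ̄ = trans (α≡αβ⊗conj α β Nβ≡1) (cong (_⊗ conj β) αβ≡Y)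

  reduced⇒unitForm : ∀ d .{{_ : NonZero d}} α β → AlmostIntegral α → AlmostIntegral β → α ≢ 𝟘 →
                     ReducedEquation (int (+ d)) α β → UnitForm d (α , α ⊗ β , α ⊗ (β ⊗ β))
  reduced⇒unitForm d α β α∈A β∈A α≢0 reduced = conclude (trace-integer β∈A)
    where
    Nβ≡1 : norm β ≡ 1ℚ
    Nβ≡1 = ratio-norm≡1 (+ d) α β α∈A β∈A reduced

    conclude : ∃[ T ] β ⊕ conj β ≡ int T → UnitForm d (α , α ⊗ β , α ⊗ (β ⊗ β))
    conclude (T , trace≡T) = unitForm d α β β∈A Nβ≡1 α≢0 T trace≡T
      (middle-integer {d} {α ⊗ β} {T ℤ.* T ℤ.- + 1} (⊗-almostIntegral α∈A β∈A)
        (d⊗αβ≡T²-1 (+ d) α β T Nβ≡1 trace≡T reduced))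

  solution⇒unitForm : ∀ {d} .{{_ : NonZero d}} {t} → 𝓖𝓟₁₁₁ ℚ[√- D ] d t → UnitForm d t
  solution⇒unitForm {d} {x , y , z} (_ , ((α , α-int) , (β , β-int) , (refl , refl , refl) , α≢0) , eq) =
    reduced⇒unitForm d α β (integral⇒almostIntegral {α} α-int) (integral⇒almostIntegral {β} β-int) α≢0
      (reduce-equation (int (+ d)) α (proj₁ (inverse α α≢0)) β (proj₂ (inverse α α≢0)) eq)

  -- The three cases of the trace

  -- T² = 4a² ≤ 4(a² + Db²) = 4 for β = a + b√-D.
  trace-bound : ∀ β T → norm β ≡ 1ℚ → β ⊕ conj β ≡ int T → T ℤ.* T ℤ.≤ + 4
  trace-bound ⟨ a , b ⟩ T Nβ≡1 trace≡T = ℤ⇒ℚ-cancel-≤ (begin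
    ℤ⇒ℚ (T ℤ.* T)                        ≡⟨ ℤ⇒ℚ-* T T ⟩
    ℤ⇒ℚ T ℚ.* ℤ⇒ℚ T                      ≡⟨ cong (λ τ → τ ℚ.* τ) (cong Quadratic.ratPart trace≡T) ⟨
    (a ℚ.+ a) ℚ.* (a ℚ.+ a)              ≡⟨ ℚ.+-identityʳ _ ⟨
    (a ℚ.+ a) ℚ.* (a ℚ.+ a) ℚ.+ 0ℚ       ≤⟨ ℚ.+-monoʳ-≤ ((a ℚ.+ a) ℚ.* (a ℚ.+ a)) (ℚ.nonNegative⁻¹ 4δb² {{4δb²≥0}}) ⟩
    (a ℚ.+ a) ℚ.* (a ℚ.+ a) ℚ.+ 4δb²     ≡⟨ 4norm a b δ ⟩
    ℤ⇒ℚ (+ 4) ℚ.* norm ⟨ a , b ⟩         ≡⟨ cong (ℤ⇒ℚ (+ 4) ℚ.*_) Nβ≡1 ⟩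
    ℤ⇒ℚ (+ 4)                            ∎)
    where
    open ℚ.≤-Reasoning
    open +-*-Solver
    4δb² : ℚ
    4δb² = ℤ⇒ℚ (+ 4) ℚ.* (δ ℚ.* (b ℚ.* b))
    4δb²≥0 : ℚ.NonNegative 4δb²
    4δb²≥0 = ℚ.nonNeg*nonNeg⇒nonNeg (ℤ⇒ℚ (+ 4)) (δ ℚ.* (b ℚ.* b))
      {{ℚ.nonNeg*nonNeg⇒nonNeg δ {{ℚ.pos⇒nonNeg δ {{positive-δ}}}} (b ℚ.* b) {{nonNegative-square b}}}}
    4norm : ∀ a b D → (a ℚ.+ a) ℚ.* (a ℚ.+ a) ℚ.+ ℤ⇒ℚ (+ 4) ℚ.* (D ℚ.* (b ℚ.* b))
                    ≡ ℤ⇒ℚ (+ 4) ℚ.* (a ℚ.* a ℚ.+ D ℚ.* (b ℚ.* b))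
    4norm = solve 3 (λ a b D → (a :+ a) :* (a :+ a) :+ con (ℤ⇒ℚ (+ 4)) :* (D :* (b :* b))
                            := con (ℤ⇒ℚ (+ 4)) :* (a :* a :+ D :* (b :* b))) refl

  double-trace⇒rational : ∀ β {ε} → Sign ε → norm β ≡ 1ℚ → β ⊕ conj β ≡ int (ε ℤ.+ ε) → β ≡ int ε
  double-trace⇒rational ⟨ a , b ⟩ {ε} sign Nβ≡1 trace≡2ε = cong₂ ⟨_,_⟩ a≡ε
    (p*p≡0⇒p≡0 b (p*q≡0⇒q≡0 δ (b ℚ.* b) {{ℚ.pos⇒nonZero δ {{positive-δ}}}}
      (∙-cancelˡ 1ℚ (δ ℚ.* (b ℚ.* b)) 0ℚ (begin
        1ℚ ℚ.+ δ ℚ.* (b ℚ.* b)         ≡⟨ cong (ℚ._+ δ ℚ.* (b ℚ.* b)) (trans (cong (λ a → a ℚ.* a) a≡ε) (ε²≡1 sign)) ⟨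
        norm ⟨ a , b ⟩                 ≡⟨ Nβ≡1 ⟩
        1ℚ ℚ.+ 0ℚ                      ∎))))
    where
    open ≡-Reasoning
    open GroupProperties ℚ.+-0-group using (∙-cancelˡ)
    a≡ε : a ≡ ℤ⇒ℚ ε
    a≡ε = p+p≡q+q⇒p≡q a (ℤ⇒ℚ ε) (trans (cong Quadratic.ratPart trace≡2ε) (ℤ⇒ℚ-+ ε ε))
    ε²≡1 : ∀ {ε} → Sign ε → ℤ⇒ℚ ε ℚ.* ℤ⇒ℚ ε ≡ 1ℚ
    ε²≡1 plus  = refl
    ε²≡1 minus = refl

  zero-trace⇒imaginary : ∀ β → β ⊕ conj β ≡ int (+ 0) → ∃[ b ] β ≡ ⟨ 0ℚ , b ⟩
  zero-trace⇒imaginary ⟨ a , b ⟩ trace≡0 =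
    b , cong ⟨_, b ⟩ (p+p≡q+q⇒p≡q a 0ℚ (cong Quadratic.ratPart trace≡0))

  -- An integral b√-D of norm Db² = 1 makes -Db, its product with √-D, an integer e
  -- with e² = D·Db² = D.
  imaginary-unit⇒square : ∀ b → AlmostIntegral ⟨ 0ℚ , b ⟩ → norm ⟨ 0ℚ , b ⟩ ≡ 1ℚ →
                          ∃[ e ] ℚ.- (δ ℚ.* b) ≡ ℤ⇒ℚ e × e ℤ.* e ≡ + D
  imaginary-unit⇒square b β∈A Nβ≡1 = conclude
    (rational-almostIntegral (subst AlmostIntegral (√-D⊗ b δ) (⊗-almostIntegral (lattice⇒almostIntegral √-D∈Lattice) β∈A)))
    where
    open ≡-Reasoning
    √-D⊗ : ∀ b D → _≡_ {A = K} ⟨ 0ℚ ℚ.* 0ℚ ℚ.- D ℚ.* (1ℚ ℚ.* b) , 0ℚ ℚ.* b ℚ.+ 1ℚ ℚ.* 0ℚ ⟩ (ι (ℚ.- (D ℚ.* b)))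
    √-D⊗ b D = cong₂ ⟨_,_⟩
      (solve 2 (λ b D → con 0ℚ :* con 0ℚ :- D :* (con 1ℚ :* b) := :- (D :* b)) refl b D)
      (solve 1 (λ b → con 0ℚ :* b :+ con 1ℚ :* con 0ℚ := con 0ℚ) refl b)
      where open +-*-Solver
    square : ∀ b D → (ℚ.- (D ℚ.* b)) ℚ.* (ℚ.- (D ℚ.* b)) ≡ D ℚ.* (0ℚ ℚ.* 0ℚ ℚ.+ D ℚ.* (b ℚ.* b))
    square = solve 2 (λ b D → (:- (D :* b)) :* (:- (D :* b)) := D :* (con 0ℚ :* con 0ℚ :+ D :* (b :* b))) refl
      where open +-*-Solver
    conclude : ∃[ e ] ℚ.- (δ ℚ.* b) ≡ ℤ⇒ℚ e → ∃[ e ] ℚ.- (δ ℚ.* b) ≡ ℤ⇒ℚ e × e ℤ.* e ≡ + D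
    conclude (e , eq) = e , eq , ℤ⇒ℚ-injective (begin
      ℤ⇒ℚ (e ℤ.* e)                         ≡⟨ ℤ⇒ℚ-* e e ⟩
      ℤ⇒ℚ e ℚ.* ℤ⇒ℚ e                       ≡⟨ cong (λ q → q ℚ.* q) eq ⟨
      (ℚ.- (δ ℚ.* b)) ℚ.* (ℚ.- (δ ℚ.* b))   ≡⟨ square b δ ⟩
      δ ℚ.* norm ⟨ 0ℚ , b ⟩                 ≡⟨ cong (δ ℚ.*_) Nβ≡1 ⟩
      δ ℚ.* 1ℚ                              ≡⟨ ℚ.*-identityʳ δ ⟩
      δ                                     ∎)

  -- A solution of ratio b√-D and middle term -1, with the witness e = -Db that D
  -- is a square.
  Exceptional : ℕ → NumberField.Triple ℚ[√- D ] → Set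
  Exceptional d t = d ≡ 1 × ∃[ b ] ∃[ e ] ℚ.- (δ ℚ.* b) ≡ ℤ⇒ℚ e × e ℤ.* e ≡ + D
    × t ≡ (int -[1+ 0 ] ⊗ conj ⟨ 0ℚ , b ⟩ , int -[1+ 0 ] , int -[1+ 0 ] ⊗ ⟨ 0ℚ , b ⟩)

  classify-trace : ∀ d .{{_ : NonZero d}} β Y {T} → SmallTrace T → AlmostIntegral β → norm β ≡ 1ℚ →
                   β ⊕ conj β ≡ int T → + d ℤ.* Y ≡ T ℤ.* T ℤ.- + 1 → Y ≢ + 0 →
                   Image ℚ[√- D ] (_∈ rationalSolutions d) (int Y ⊗ conj β , int Y , int Y ⊗ β)
                   ⊎ Exceptional d (int Y ⊗ conj β , int Y , int Y ⊗ β)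
  classify-trace d β Y zeroTrace β∈A Nβ≡1 trace≡T dY≡ Y≢0 =
    inj₂ (conclude (zero-trace⇒imaginary β trace≡T) (d*Y≡-1⇒factors d Y dY≡))
    where
    conclude : ∃[ b ] β ≡ ⟨ 0ℚ , b ⟩ → d ≡ 1 × Y ≡ -[1+ 0 ] →
               Exceptional d (int Y ⊗ conj β , int Y , int Y ⊗ β)
    conclude (b , refl) (d≡1 , refl) = d≡1 , b , with-root (imaginary-unit⇒square b β∈A Nβ≡1)
      where
      with-root : ∃[ e ] ℚ.- (δ ℚ.* b) ≡ ℤ⇒ℚ e × e ℤ.* e ≡ + D → _
      with-root (e , eq , e²≡D) = e , eq , e²≡D , refl
  classify-trace d β Y {T} (unitTrace T²≡1) β∈A Nβ≡1 trace≡T dY≡ Y≢0 = contradiction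
    (ℤ.*-cancelˡ-≡ (+ d) Y (+ 0) (trans dY≡ (trans (cong (ℤ._- + 1) T²≡1) (sym (ℤ.*-zeroʳ (+ d)))))) Y≢0
  classify-trace d β Y (doubleTrace {ε} sign) β∈A Nβ≡1 trace≡T dY≡ Y≢0 =
    inj₁ (conclude (double-trace⇒rational β sign Nβ≡1 trace≡T))
    where
    4ε²-1≡3 : ∀ {ε} → Sign ε → (ε ℤ.+ ε) ℤ.* (ε ℤ.+ ε) ℤ.- + 1 ≡ + 3
    4ε²-1≡3 plus  = refl
    4ε²-1≡3 minus = refl
    conclude : β ≡ int ε → Image ℚ[√- D ] (_∈ rationalSolutions d) (int Y ⊗ conj β , int Y , int Y ⊗ β)
    conclude refl = _ , _ , _ , ε-solution∈ d Y sign (trans dY≡ (4ε²-1≡3 sign))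
                  , sym (int-* Y ε) , refl , sym (int-* Y ε)

  classify : ∀ {d} .{{_ : NonZero d}} {t} → 𝓖𝓟₁₁₁ ℚ[√- D ] d t →
             Image ℚ[√- D ] (_∈ rationalSolutions d) t ⊎ Exceptional d t
  classify {d} {t} sol = conclude (solution⇒unitForm sol)
    where
    conclude : UnitForm d t → Image ℚ[√- D ] (_∈ rationalSolutions d) t ⊎ Exceptional d t
    conclude record { β = β ; Y = Y ; T = T ; β-integral = β∈A ; norm≡1 = Nβ≡1 ; trace≡T = trace≡T
                    ; dY≡T²-1 = dY≡T²-1 ; Y≢0 = Y≢0 ; triple = refl } =
      classify-trace d β Y (t*t≤4⇒small T (trace-bound β T Nβ≡1 trace≡T)) β∈A Nβ≡1 trace≡T dY≡T²-1 Y≢0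

  -- Rational solutions as solutions over K

  -- The embedding of rational triples in triples over K.
  ι³ : ℚ × ℚ × ℚ → NumberField.Triple ℚ[√- D ]
  ι³ (p , q , r) = ι p , ι q , ι r

  ι³-injective : ∀ {s t} → ι³ s ≡ ι³ t → s ≡ t
  ι³-injective {_ , _ , _} {_ , _ , _} refl = refl

  horner-ι : ∀ cs p → horner cs (ι p) ≡ ι (NumberField.evalMonic ℚ-numberField cs p)
  horner-ι []       p = refl
  horner-ι (c ∷ cs) p = cong (int c ⊕_) (trans (cong (ι p ⊗_) (horner-ι cs p))
    (sym (ι-* p (NumberField.evalMonic ℚ-numberField cs p))))

  ι-integral : ∀ {p} → NumberField.Integral ℚ-numberField p → NumberField.Integral ℚ[√- D ] (ι p)
  ι-integral {p} (cs , eq) = cs , trans (evalMonic≡horner cs (ι p)) (trans (horner-ι cs p) (cong ι eq))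

  ι³-solution : ∀ {d t} → 𝓖𝓟₁₁₁ ℚ-numberField d t → 𝓖𝓟₁₁₁ ℚ[√- D ] d (ι³ t)
  ι³-solution {d} {x , y , z} ((x-int , y-int , z-int) , ((α , α-int) , (β , β-int) , (x≡ , y≡ , z≡) , α≢0) , eq) =
      (ι-integral x-int , ι-integral y-int , ι-integral z-int)
    , ( (ι α , ι-integral α-int) , (ι β , ι-integral β-int)
      , ( cong ι x≡
        , trans (cong ι y≡) (ι-* α β)
        , trans (cong ι z≡) (trans (ι-* α (β ℚ.* β)) (cong (ι α ⊗_) (ι-* β β))))
      , λ ια≡0 → α≢0 (cong Quadratic.ratPart ια≡0))
    , (begin
      ι 1ℚ ⊗ (ι x ⊗ ι x) ⊕ ι 1ℚ ⊗ (ι y ⊗ ι y) ⊕ ι 1ℚ ⊗ (ι z ⊗ ι z)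
        ≡⟨ cong₂ _⊕_ (cong₂ _⊕_ (ι-1p² x) (ι-1p² y)) (ι-1p² z) ⟨
      ι (1ℚ ℚ.* (x ℚ.* x) ℚ.+ 1ℚ ℚ.* (y ℚ.* y) ℚ.+ 1ℚ ℚ.* (z ℚ.* z))
        ≡⟨ cong ι eq ⟩
      ι (ℤ⇒ℚ (+ d) ℚ.* (x ℚ.* y ℚ.* z))
        ≡⟨ ι-* (ℤ⇒ℚ (+ d)) (x ℚ.* y ℚ.* z) ⟩
      int (+ d) ⊗ ι (x ℚ.* y ℚ.* z)
        ≡⟨ cong (int (+ d) ⊗_) (trans (ι-* (x ℚ.* y) z) (cong (_⊗ ι z) (ι-* x y))) ⟩
      int (+ d) ⊗ (ι x ⊗ ι y ⊗ ι z) ∎)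
    where
    open ≡-Reasoning
    ι-1p² : ∀ p → ι (1ℚ ℚ.* (p ℚ.* p)) ≡ ι 1ℚ ⊗ (ι p ⊗ ι p)
    ι-1p² p = trans (ι-* 1ℚ (p ℚ.* p)) (cong (ι 1ℚ ⊗_) (ι-* p p))

  Image-⊆ : ∀ {P Q : ℚ × ℚ × ℚ → Set} → (∀ {t} → P t → Q t) →
            ∀ {t} → Image ℚ[√- D ] P t → Image ℚ[√- D ] Q t
  Image-⊆ P⊆Q (p , q , r , Pt , eqs) = p , q , r , P⊆Q Pt , eqs

  -- A rational solution is a solution over K, and ι³ is injective.
  rationalSolutions-complete : ∀ {d} → (∀ {t} → 𝓖𝓟₁₁₁ ℚ[√- D ] d t → Image ℚ[√- D ] (_∈ rationalSolutions d) t) →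
                               ∀ {t} → 𝓖𝓟₁₁₁ ℚ-numberField d t → t ∈ rationalSolutions d
  rationalSolutions-complete {d} K-solutions {t} sol = conclude (K-solutions {ι³ t} (ι³-solution {d} {t} sol))
    where
    conclude : Image ℚ[√- D ] (_∈ rationalSolutions d) (ι³ t) → t ∈ rationalSolutions d
    conclude (_ , _ , _ , s∈ , x≡ , y≡ , z≡) =
      subst (_∈ rationalSolutions d) (sym (ι³-injective (cong₂ _,_ x≡ (cong₂ _,_ y≡ z≡)))) s∈

  -- D = e² is squarefree only for D = 1.
  ¬exceptional : ∀ {d t} → Squarefree D → (d , D) ≢ (1 , 1) → ¬ Exceptional d t
  ¬exceptional squarefree dD≢11 (d≡1 , _ , e , _ , e²≡D , _) = dD≢11 (cong₂ _,_ d≡1 D≡1)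
    where
    ∣e∣²≡D : ℤ.∣ e ∣ ℕ.* ℤ.∣ e ∣ ≡ D
    ∣e∣²≡D = trans (sym (ℤ.abs-* e e)) (cong ℤ.∣_∣ e²≡D)

    D≡1 : D ≡ 1
    D≡1 = trans (sym ∣e∣²≡D) (cong (λ n → n ℕ.* n) (squarefree ℤ.∣ e ∣ (divides 1 (trans (sym ∣e∣²≡D) (sym (ℕ.*-identityˡ _))))))

  module _ {d} .{{_ : NonZero d}} (squarefree : Squarefree D) (dD≢11 : (d , D) ≢ (1 , 1)) where

    solution⇒rational : ∀ {t} → 𝓖𝓟₁₁₁ ℚ[√- D ] d t → Image ℚ[√- D ] (_∈ rationalSolutions d) t
    solution⇒rational {t} sol = conclude (classify sol)
      where
      conclude : Image ℚ[√- D ] (_∈ rationalSolutions d) t ⊎ Exceptional d t → Image ℚ[√- D ] (_∈ rationalSolutions d) t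
      conclude (inj₁ rational)    = rational
      conclude (inj₂ exceptional) = contradiction exceptional (¬exceptional squarefree dD≢11)

    solutions≐ : 𝓖𝓟₁₁₁ ℚ[√- D ] d ≐ Image ℚ[√- D ] (𝓖𝓟₁₁₁ ℚ-numberField d)
    solutions≐ = (λ {t} sol → Image-⊆ (rationalSolutions⊆ d) {t} (solution⇒rational {t} sol))
               , λ { (p , q , r , sol , refl , refl , refl) → ι³-solution {d} {p , q , r} sol }

    rationalSolutions≐ : 𝓖𝓟₁₁₁ ℚ-numberField d ≐ (_∈ rationalSolutions d)
    rationalSolutions≐ = (λ {t} → rationalSolutions-complete {d} (λ {t} → solution⇒rational {t}) {t}) , rationalSolutions⊆ d

-- The Gaussian field

module Gaussian where

  open QuadraticField 1
  open QuadraticIntegers 1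

  -- D = 1, so e = ±1 and the ratio is b·i with b = -e.
  exceptional⇒∈ : ∀ {t} → Exceptional 1 t → t ∈ gaussianSolutions
  exceptional⇒∈ (_ , b , e , -b≡e , e²≡1 , t≡) = conclude (i*i≡1⇒sign e e²≡1) b≡-e t≡
    where
    open GroupProperties ℚ.+-0-group using (⁻¹-involutive)
    b≡-e : b ≡ ℚ.- ℤ⇒ℚ e
    b≡-e = trans (sym (⁻¹-involutive b)) (cong ℚ.-_ (trans (cong ℚ.-_ (sym (ℚ.*-identityˡ b))) -b≡e))
    conclude : ∀ {e b t} → Sign e → b ≡ ℚ.- ℤ⇒ℚ e →
               t ≡ (int -[1+ 0 ] ⊗ conj ⟨ 0ℚ , b ⟩ , int -[1+ 0 ] , int -[1+ 0 ] ⊗ ⟨ 0ℚ , b ⟩) →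
               t ∈ gaussianSolutions
    conclude plus  refl refl = there (there (there (here refl)))
    conclude minus refl refl = there (there (here refl))

  rational⇒∈ : ∀ {t} → Image ℚ[√- 1 ] (_∈ rationalSolutions 1) t → t ∈ gaussianSolutions
  rational⇒∈ (_ , _ , _ , here refl , refl , refl , refl)         = here refl
  rational⇒∈ (_ , _ , _ , there (here refl) , refl , refl , refl) = there (here refl)

  -- Both ±i are roots of X² + 1.
  i-integral : NumberField.Integral ℚ[√- 1 ] √-D
  i-integral = (+ 1 ∷ + 0 ∷ []) , refl

  -i-integral : NumberField.Integral ℚ[√- 1 ] (⊖ √-D)
  -i-integral = (+ 1 ∷ + 0 ∷ []) , refl

  ∈⇒solution : ∀ {t} → t ∈ gaussianSolutions → 𝓖𝓟₁₁₁ ℚ[√- 1 ] 1 t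
  ∈⇒solution (here refl)         = ι³-solution {1} (rationalSolutions⊆ 1 (here refl))
  ∈⇒solution (there (here refl)) = ι³-solution {1} (rationalSolutions⊆ 1 (there (here refl)))
  ∈⇒solution (there (there (here refl))) =
      (i-integral , fromℤ-integral -[1+ 0 ] , -i-integral)
    , ((√-D , i-integral) , (√-D , i-integral) , (refl , refl , refl) , λ ()) , refl
    where open NumberField ℚ[√- 1 ] using (fromℤ-integral)
  ∈⇒solution (there (there (there (here refl)))) =
      (-i-integral , fromℤ-integral -[1+ 0 ] , i-integral)
    , ((⊖ √-D , -i-integral) , (⊖ √-D , -i-integral) , (refl , refl , refl) , λ ()) , refl
    where open NumberField ℚ[√- 1 ] using (fromℤ-integral)

  solution⇒∈ : ∀ {t} → 𝓖𝓟₁₁₁ ℚ[√- 1 ] 1 t → t ∈ gaussianSolutions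
  solution⇒∈ {t} sol = conclude (classify sol)
    where
    conclude : Image ℚ[√- 1 ] (_∈ rationalSolutions 1) t ⊎ Exceptional 1 t → t ∈ gaussianSolutions
    conclude (inj₁ rational)    = rational⇒∈ rational
    conclude (inj₂ exceptional) = exceptional⇒∈ exceptional

  gaussianSolutions≐ : 𝓖𝓟₁₁₁ ℚ[√- 1 ] 1 ≐ (_∈ gaussianSolutions)
  gaussianSolutions≐ = (λ {t} → solution⇒∈ {t}) , (λ {t} → ∈⇒solution {t})

theorem4p5 : (∀ (d D : ℕ) .{{_ : NonZero d}} .{{_ : NonZero D}} →
    Squarefree D → (d , D) ≢ (1 , 1) →
    𝓖𝓟₁₁₁ ℚ[√- D ] d ≐ Image ℚ[√- D ] (𝓖𝓟₁₁₁ ℚ-numberField d)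
    × 𝓖𝓟₁₁₁ ℚ-numberField d ≐ (_∈ rationalSolutions d))
    × 𝓖𝓟₁₁₁ ℚ[√- 1 ] 1 ≐ (_∈ gaussianSolutions)
theorem4p5 =
    (λ d D {{d≢0}} {{D≢0}} squarefree dD≢11 →
        QuadraticIntegers.solutions≐ D {{D≢0}} {d} {{d≢0}} squarefree dD≢11
      , QuadraticIntegers.rationalSolutions≐ D {{D≢0}} {d} {{d≢0}} squarefree dD≢11)
  , Gaussian.gaussianSolutions≐
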